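{- Let $n\ge3$ and let $M=\begin{pmatrix} x_1 & x_2 & \cdots & x_n\\ y_1 & y_2 & \cdots & y_n\end{pmatrix}$ be a 1-prime $2\times n$ integer matrix with $Y_{ij}:=x_iy_j-x_jy_i>0$ for all $1\le i<j\le n$. Let $1\le i<j\le n$, let $\mathbf n=(n_1,n_2)^T\in\mathbb Z^2$, and let $m$ be any integer with $1\le m\le n$, $m\ne i,j$. Then $$\frac{1}{Y_{ij}}\sum_{\theta^{M_{ij}}=1,\ \theta\ne e}\theta^{\mathbf n}\prod_{\omega\in M\setminus M_{ij}}\frac{1}{1-\theta^{ -\omega}}=\sigma_{t_{ij}}(C_{ij};Y_{ij}),$$ where $f,g\in\mathbb Z$ satisfy $\gcd(fY_{im}+gY_{jm},Y_{ij})=1$, the integer $(fY_{im}+gY_{jm})^{ -1}$ satisfies $(fY_{im}+gY_{jm})^{ -1}(fY_{im}+gY_{jm})\equiv1 \pmod{Y_{ij}}$, $C_{ij}$ is the multiset of the $n-2$ integers $$(fY_{im}+gY_{jm})^{ -1}\bigl(-(fy_i+gy_j)x_h+(fx_i+gx_j)y_h\bigr),\qquad 1\le h\le n,\ h\ne i,\ h\neq j,$$ and $$t_{ij}=(fY_{im}+gY_{jm})^{ -1}\bigl(-(fy_i+gy_j)n_1+(fx_i+gx_j)n_2\bigr)+\sum_{c\in C_{ij}}c.$$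
   Context: $Y_{ab}=x_ay_b-x_by_a$ for all indices $a,b$. The condition $Y_{ij}>0$ for $i<j$ expresses that the columns are ordered by increasing slope (when all $x_i>0$ it reads $\frac{y_1}{x_1}<\cdots<\frac{y_n}{x_n}$). A $2\times n$ integer matrix is 1-prime if for every choice of three of its columns spanning $\mathbb R^2$, the gcd of the absolute values of the nonzero $2\times2$ minors formed from these columns is $1$. $M_{ij}$ is the $2\times2$ matrix formed by the $i$-th and $j$-th columns of $M$, and $M\setminus M_{ij}$ is the multiset of the remaining columns. For $\theta=(\theta_1,\theta_2)\in(\mathbb C\setminus\{0\})^2$ and $a=(a_1,a_2)^T\in\mathbb Z^2$, $\theta^a=\theta_1^{a_1}\theta_2^{a_2}$; $e=(1,1)$; the condition $\theta^{M_{ij}}=1$ means $\theta^{w}=1$ for both columns $w$ of $M_{ij}$, and the sum runs over all such $\theta\in(\mathbb C\setminus\{0\})^2$ other than $e$. The Fourier–Dedekind sum is, for a positive integer $N$, a finite multiset $C$ of integers, and an integer $t$, $\sigma_t(C;N)=\frac1N\sum_{\lambda^N=1,\ \lambda\ne1}\frac{\lambda^t}{\prod_{c\in C}(\lambda^c-1)}$ (sum over complex $N$-th roots of unity $\lambda\ne1$; it is $0$ if $N=1$). -}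

module Defs where

open import Algebra.Bundles using (CommutativeRing; Semiring)
import Algebra.Definitions.RawSemiring as RawSemiringDefinitions
open import Data.Fin.Base as Fin using (Fin)
import Data.Fin.Properties as Fin
open import Data.Integer.Base as ℤ using (ℤ; +_; -[1+_]; 0ℤ; 1ℤ)
open import Data.List.Base using (List; []; _∷_; map; foldr; filter; allFin)
import Data.List.Membership.Setoid as Membership
open import Data.List.Relation.Unary.All as All using (All; reduce)
import Data.List.Relation.Unary.Unique.Setoid as Uniqueness
open import Data.Nat.Base as ℕ using (ℕ; suc)
import Data.Nat.GCD as ℕ
import Data.Nat.Properties as ℕ
open import Data.Product.Base using (∃; ∃-syntax; _×_; _,_; proj₁; proj₂)
open import Data.Product.Relation.Binary.Pointwise.NonDependent using (×-setoid)
open import Data.Rational.Base as ℚ using (ℚ; 0ℚ; 1ℚ; ½)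
import Data.Rational.Properties as ℚ
import Data.Rational.Solver as ℚ
open import Data.Sum.Base using (_⊎_)
open import Data.Vec.Functional using (Vector)
open import Function.Base using (_∘_)
open import Level using (0ℓ)
open import Relation.Binary.Bundles using (Setoid)
import Relation.Binary.Construct.On as On
open import Relation.Binary.PropositionalEquality
  using (_≡_; _≢_; _≗_; refl; sym; trans; cong; cong₂; subst; subst₂)
open import Relation.Nullary.Decidable using (yes; no; ¬?; _×-dec_)
open import Relation.Nullary.Negation using (contradiction)

open ℚ.+-*-Solver using (solve; con; _:+_; _:*_; :-_; _:-_; _:=_)

private

  half-pos : ∀ {ε} → 0ℚ ℚ.< ε → 0ℚ ℚ.< ½ ℚ.* ε
  half-pos {ε} ε>0 =
    ℚ.positive⁻¹ (½ ℚ.* ε) {{ℚ.pos*pos⇒pos ½ ε {{ℚ.positive ε>0}}}}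

  *-pos : ∀ {p q} → 0ℚ ℚ.< p → 0ℚ ℚ.< q → 0ℚ ℚ.< p ℚ.* q
  *-pos {p} {q} p>0 q>0 =
    ℚ.positive⁻¹ (p ℚ.* q) {{ℚ.pos*pos⇒pos p {{ℚ.positive p>0}} q {{ℚ.positive q>0}}}}

  halves : ∀ ε → ½ ℚ.* ε ℚ.+ ½ ℚ.* ε ≡ ε
  halves = solve 1 (λ e → con ½ :* e :+ con ½ :* e := e) refl

  -- For B > 0, a δ > 0 with B δ = ε.
  shrink : ∀ {B ε} → 0ℚ ℚ.< B → 0ℚ ℚ.< ε → ∃[ δ ] 0ℚ ℚ.< δ × B ℚ.* δ ≡ ε
  shrink {B} {ε} B>0 ε>0 = B⁻¹ ℚ.* ε , *-pos B⁻¹>0 ε>0 , eq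
    where
    instance
      B+ = ℚ.positive B>0
      B≢0 = ℚ.pos⇒nonZero B
    B⁻¹ = ℚ.1/ B
    B⁻¹>0 = ℚ.positive⁻¹ B⁻¹ {{ℚ.1/pos⇒pos B}}
    eq : B ℚ.* (B⁻¹ ℚ.* ε) ≡ ε
    eq = trans (sym (ℚ.*-assoc B B⁻¹ ε))
           (trans (cong (ℚ._* ε) (ℚ.*-inverseʳ B)) (ℚ.*-identityˡ ε))

  sum-small : ∀ {p q ε} → ℚ.∣ p ∣ ℚ.< ½ ℚ.* ε → ℚ.∣ q ∣ ℚ.< ½ ℚ.* ε →
              ℚ.∣ p ℚ.+ q ∣ ℚ.< ε
  sum-small {p} {q} {ε} p< q< = begin-strict
    ℚ.∣ p ℚ.+ q ∣            ≤⟨ ℚ.∣p+q∣≤∣p∣+∣q∣ p q ⟩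
    ℚ.∣ p ∣ ℚ.+ ℚ.∣ q ∣      <⟨ ℚ.+-mono-< p< q< ⟩
    ½ ℚ.* ε ℚ.+ ½ ℚ.* ε      ≡⟨ halves ε ⟩
    ε                        ∎
    where open ℚ.≤-Reasoning

  prod-small : ∀ {p q B δ} → 0ℚ ℚ.< B → ℚ.∣ p ∣ ℚ.≤ B → ℚ.∣ q ∣ ℚ.< δ →
               ℚ.∣ p ℚ.* q ∣ ℚ.< B ℚ.* δ
  prod-small {p} {q} {B} {δ} B>0 p≤ q< = begin-strict
    ℚ.∣ p ℚ.* q ∣        ≡⟨ ℚ.∣p*q∣≡∣p∣*∣q∣ p q ⟩
    ℚ.∣ p ∣ ℚ.* ℚ.∣ q ∣  ≤⟨ ℚ.*-monoʳ-≤-nonNeg ℚ.∣ q ∣ {{ℚ.∣-∣-nonNeg q}} p≤ ⟩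
    B ℚ.* ℚ.∣ q ∣        <⟨ ℚ.*-monoʳ-<-pos B {{ℚ.positive B>0}} q< ⟩
    B ℚ.* δ              ∎
    where open ℚ.≤-Reasoning

  *-mono-≤ : ∀ {ε p q} → 0ℚ ℚ.< ε → ε ℚ.≤ p → ε ℚ.≤ q → ε ℚ.* ε ℚ.≤ p ℚ.* q
  *-mono-≤ {ε} {p} {q} ε>0 ε≤p ε≤q = ℚ.≤-trans
    (ℚ.*-monoʳ-≤-nonNeg ε {{ε≥0}} ε≤p)
    (ℚ.*-monoˡ-≤-nonNeg p {{ℚ.nonNegative (ℚ.≤-trans (ℚ.<⇒≤ ε>0) ε≤p)}} ε≤q)
    where ε≥0 = ℚ.pos⇒nonNeg ε {{ℚ.positive ε>0}}

  ∣-∣-swap : ∀ p q → ℚ.∣ p ℚ.- q ∣ ≡ ℚ.∣ q ℚ.- p ∣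
  ∣-∣-swap p q = trans (sym (ℚ.∣-p∣≡∣p∣ (p ℚ.- q)))
    (cong ℚ.∣_∣ (solve 2 (λ p q → :- (p :- q) := q :- p) refl p q))

  recip : ℚ → ℚ
  recip p with p ℚ.≟ 0ℚ
  ... | yes _   = 0ℚ
  ... | no  p≢0 = (ℚ.1/ p) {{ℚ.≢-nonZero p≢0}}

  recip-inverseʳ : ∀ {ε} p → 0ℚ ℚ.< ε → ε ℚ.≤ ℚ.∣ p ∣ → p ℚ.* recip p ≡ 1ℚ
  recip-inverseʳ {ε} p ε>0 ε≤ with p ℚ.≟ 0ℚ
  ... | yes refl = contradiction (ℚ.<-≤-trans ε>0 ε≤) (ℚ.<-irrefl refl)
  ... | no  p≢0  = ℚ.*-inverseʳ p {{ℚ.≢-nonZero p≢0}}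

Eventually : (ℕ → Set) → Set
Eventually P = ∃[ N ] ∀ n → N ℕ.≤ n → P n

infixr 4 _∧ᵉ_

_∧ᵉ_ : ∀ {P Q} → Eventually P → Eventually Q → Eventually (λ n → P n × Q n)
(M , p) ∧ᵉ (N , q) = M ℕ.⊔ N , λ n le →
  p n (ℕ.≤-trans (ℕ.m≤m⊔n M N) le) , q n (ℕ.≤-trans (ℕ.m≤n⊔m M N) le)

mapᵉ : ∀ {P Q} → (∀ n → P n → Q n) → Eventually P → Eventually Q
mapᵉ f (N , p) = N , λ n le → f n (p n le)

-- Cauchy sequences of rationals; equality (Real._≈_) is modulo null sequences.
-- There is no η, and the operations are given by copatterns, so that sums and
-- products of reals do not unfold during conversion checking.
record ℝ : Set where
  no-eta-equality
  field
    seq    : ℕ → ℚ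
    cauchy : ∀ {ε} → 0ℚ ℚ.< ε →
             ∃[ N ] ∀ m n → N ℕ.≤ m → N ℕ.≤ n → ℚ.∣ seq m ℚ.- seq n ∣ ℚ.< ε

open ℝ

module Real where

  infix  4 _≈_
  infix  5 _#0
  infixl 6 _+_
  infixl 7 _*_
  infix  8 -_

  record _≈_ (x y : ℝ) : Set where
    constructor null
    field
      close : ∀ {ε} → 0ℚ ℚ.< ε → Eventually (λ n → ℚ.∣ seq x n ℚ.- seq y n ∣ ℚ.< ε)

  _#0 : ℝ → Set
  x #0 = ∃[ ε ] 0ℚ ℚ.< ε × Eventually (λ n → ε ℚ.≤ ℚ.∣ seq x n ∣)

  fromℚ : ℚ → ℝ
  fromℚ q .seq _ = q
  fromℚ q .cauchy {ε} ε>0 = 0 , λ _ _ _ _ →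
    subst (ℚ._< ε) (cong ℚ.∣_∣ (sym (ℚ.+-inverseʳ q))) ε>0

  eventually-bounded : ∀ x → ∃[ B ] 0ℚ ℚ.< B × Eventually (λ n → ℚ.∣ seq x n ∣ ℚ.≤ B)
  eventually-bounded x with cauchy x {1ℚ} (ℚ.positive⁻¹ 1ℚ)
  ... | N , close = B , B>0 , N , bound
    where
    xN = seq x N
    B = 1ℚ ℚ.+ ℚ.∣ xN ∣
    B>0 = ℚ.positive⁻¹ B {{ℚ.pos+nonNeg⇒pos 1ℚ ℚ.∣ xN ∣ {{ℚ.∣-∣-nonNeg xN}}}}
    bound : ∀ n → N ℕ.≤ n → ℚ.∣ seq x n ∣ ℚ.≤ B
    bound n le = begin
      ℚ.∣ seq x n ∣
        ≡⟨ cong ℚ.∣_∣ (solve 2 (λ a b → a := (a :- b) :+ b) refl (seq x n) xN) ⟩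
      ℚ.∣ (seq x n ℚ.- xN) ℚ.+ xN ∣
        ≤⟨ ℚ.∣p+q∣≤∣p∣+∣q∣ (seq x n ℚ.- xN) xN ⟩
      ℚ.∣ seq x n ℚ.- xN ∣ ℚ.+ ℚ.∣ xN ∣
        ≤⟨ ℚ.+-monoˡ-≤ ℚ.∣ xN ∣ (ℚ.<⇒≤ (close n N le ℕ.≤-refl)) ⟩
      B ∎
      where open ℚ.≤-Reasoning

  private
    -- |p p′ − q q′| is small when |p|, |q′| are bounded and |p − q|, |p′ − q′| are small.
    *-close : ∀ p p′ q q′ {B B′ δ δ′ ε} → 0ℚ ℚ.< B → 0ℚ ℚ.< B′ →
              B ℚ.* δ ≡ ½ ℚ.* ε → B′ ℚ.* δ′ ≡ ½ ℚ.* ε →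
              ℚ.∣ p ∣ ℚ.≤ B → ℚ.∣ q′ ∣ ℚ.≤ B′ →
              ℚ.∣ p′ ℚ.- q′ ∣ ℚ.< δ → ℚ.∣ p ℚ.- q ∣ ℚ.< δ′ →
              ℚ.∣ p ℚ.* p′ ℚ.- q ℚ.* q′ ∣ ℚ.< ε
    *-close p p′ q q′ {ε = ε} B>0 B′>0 Bδ Bδ′ p≤ q′≤ close′ close =
      subst (λ r → ℚ.∣ r ∣ ℚ.< ε)
        (solve 4 (λ p p′ q q′ → p :* (p′ :- q′) :+ q′ :* (p :- q) := p :* p′ :- q :* q′)
          refl p p′ q q′)
        (sum-small
          (subst (ℚ._<_ _) Bδ (prod-small {q = p′ ℚ.- q′} B>0 p≤ close′))
          (subst (ℚ._<_ _) Bδ′ (prod-small {q = p ℚ.- q} B′>0 q′≤ close)))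

  _+_ : ℝ → ℝ → ℝ
  (x + y) .seq n = seq x n ℚ.+ seq y n
  (x + y) .cauchy ε>0 =
    let M , p = cauchy x (half-pos ε>0)
        N , q = cauchy y (half-pos ε>0)
    in M ℕ.⊔ N , λ m n le le′ →
       subst (λ r → ℚ.∣ r ∣ ℚ.< _)
         (solve 4 (λ a b c d → (a :- b) :+ (c :- d) := (a :+ c) :- (b :+ d)) refl
           (seq x m) (seq x n) (seq y m) (seq y n))
         (sum-small
           (p m n (ℕ.≤-trans (ℕ.m≤m⊔n M N) le) (ℕ.≤-trans (ℕ.m≤m⊔n M N) le′))
           (q m n (ℕ.≤-trans (ℕ.m≤n⊔m M N) le) (ℕ.≤-trans (ℕ.m≤n⊔m M N) le′)))

  -_ : ℝ → ℝ
  (- x) .seq n = ℚ.- seq x n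
  (- x) .cauchy ε>0 =
    let N , p = cauchy x ε>0
    in N , λ m n le le′ →
       subst (λ r → r ℚ.< _)
         (trans (∣-∣-swap (seq x m) (seq x n))
           (cong ℚ.∣_∣ (solve 2 (λ a b → b :- a := (:- a) :- (:- b)) refl
             (seq x m) (seq x n))))
         (p m n le le′)

  _*_ : ℝ → ℝ → ℝ
  (x * y) .seq n = seq x n ℚ.* seq y n
  (x * y) .cauchy ε>0 =
    let B , B>0 , x-bd = eventually-bounded x
        B′ , B′>0 , y-bd = eventually-bounded y
        δ , δ>0 , Bδ = shrink B>0 (half-pos ε>0)
        δ′ , δ′>0 , Bδ′ = shrink B′>0 (half-pos ε>0)
        N , h = x-bd ∧ᵉ y-bd
        xN , x-cl = cauchy x δ′>0
        yN , y-cl = cauchy y δ>0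
        K = N ℕ.⊔ (xN ℕ.⊔ yN)
        N≤ = λ {n} (le : K ℕ.≤ n) → ℕ.≤-trans (ℕ.m≤m⊔n N (xN ℕ.⊔ yN)) le
        xN≤ = λ {n} (le : K ℕ.≤ n) →
          ℕ.≤-trans (ℕ.m≤m⊔n xN yN) (ℕ.≤-trans (ℕ.m≤n⊔m N (xN ℕ.⊔ yN)) le)
        yN≤ = λ {n} (le : K ℕ.≤ n) →
          ℕ.≤-trans (ℕ.m≤n⊔m xN yN) (ℕ.≤-trans (ℕ.m≤n⊔m N (xN ℕ.⊔ yN)) le)
    in K , λ m n le le′ →
       *-close (seq x m) (seq y m) (seq x n) (seq y n) B>0 B′>0 Bδ Bδ′
         (proj₁ (h m (N≤ le))) (proj₂ (h n (N≤ le′)))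
         (y-cl m n (yN≤ le) (yN≤ le′)) (x-cl m n (xN≤ le) (xN≤ le′))

  -- recip 0 = 0, but x #0 allows only finitely many terms to vanish.
  inverse : ∀ x → x #0 → ℝ
  inverse x _ .seq n = recip (seq x n)
  inverse x (ε , ε>0 , P , away) .cauchy {η} η>0 =
    let ε² = *-pos ε>0 ε>0
        N , p = cauchy x (*-pos ε² η>0)
    in P ℕ.⊔ N , λ m n le le′ →
       let a  = seq x m
           b  = seq x n
           ε≤a = away m (ℕ.≤-trans (ℕ.m≤m⊔n P N) le)
           ε≤b = away n (ℕ.≤-trans (ℕ.m≤m⊔n P N) le′)
           d = recip a ℚ.- recip b
           open ℚ.≤-Reasoning
       in ℚ.*-cancelˡ-<-nonNeg (ε ℚ.* ε) {{ℚ.pos⇒nonNeg (ε ℚ.* ε) {{ℚ.positive ε²}}}}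
            (begin-strict
              ε ℚ.* ε ℚ.* ℚ.∣ d ∣
                ≤⟨ ℚ.*-monoʳ-≤-nonNeg ℚ.∣ d ∣ {{ℚ.∣-∣-nonNeg d}} (*-mono-≤ ε>0 ε≤a ε≤b) ⟩
              ℚ.∣ a ∣ ℚ.* ℚ.∣ b ∣ ℚ.* ℚ.∣ d ∣
                ≡⟨ cong (ℚ._* ℚ.∣ d ∣) (ℚ.∣p*q∣≡∣p∣*∣q∣ a b) ⟨
              ℚ.∣ a ℚ.* b ∣ ℚ.* ℚ.∣ d ∣
                ≡⟨ ℚ.∣p*q∣≡∣p∣*∣q∣ (a ℚ.* b) d ⟨
              ℚ.∣ a ℚ.* b ℚ.* d ∣
                ≡⟨ cong ℚ.∣_∣ (solve 4 (λ a b r s →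
                     a :* b :* (r :- s) := b :* (a :* r) :- a :* (b :* s))
                     refl a b (recip a) (recip b)) ⟩
              ℚ.∣ b ℚ.* (a ℚ.* recip a) ℚ.- a ℚ.* (b ℚ.* recip b) ∣
                ≡⟨ cong₂ (λ r s → ℚ.∣ b ℚ.* r ℚ.- a ℚ.* s ∣)
                     (recip-inverseʳ a ε>0 ε≤a) (recip-inverseʳ b ε>0 ε≤b) ⟩
              ℚ.∣ b ℚ.* 1ℚ ℚ.- a ℚ.* 1ℚ ∣
                ≡⟨ cong₂ (λ r s → ℚ.∣ r ℚ.- s ∣) (ℚ.*-identityʳ b) (ℚ.*-identityʳ a) ⟩
              ℚ.∣ b ℚ.- a ∣
                <⟨ p n m (ℕ.≤-trans (ℕ.m≤n⊔m P N) le′) (ℕ.≤-trans (ℕ.m≤n⊔m P N) le) ⟩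
              ε ℚ.* ε ℚ.* η ∎)

  eventually-≡⇒≈ : ∀ {x y} → Eventually (λ n → seq x n ≡ seq y n) → x ≈ y
  eventually-≡⇒≈ {y = y} x≡y = null λ {ε} ε>0 → mapᵉ
    (λ n eq → subst (λ r → ℚ.∣ r ∣ ℚ.< ε)
      (trans (sym (ℚ.+-inverseʳ (seq y n))) (cong (ℚ._- seq y n) (sym eq))) ε>0)
    x≡y

  ≗⇒≈ : ∀ {x y} → seq x ≗ seq y → x ≈ y
  ≗⇒≈ x≗y = eventually-≡⇒≈ (0 , λ n _ → x≗y n)

  ≈-refl : ∀ {x} → x ≈ x
  ≈-refl = ≗⇒≈ (λ _ → refl)

  ≈-sym : ∀ {x y} → x ≈ y → y ≈ x
  ≈-sym {x} {y} (null p) = null λ ε>0 →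
    mapᵉ (λ n → subst (ℚ._< _) (∣-∣-swap (seq x n) (seq y n))) (p ε>0)

  ≈-trans : ∀ {x y z} → x ≈ y → y ≈ z → x ≈ z
  ≈-trans {x} {y} {z} (null p) (null q) = null λ ε>0 → mapᵉ
    (λ n (u , v) → subst (λ r → ℚ.∣ r ∣ ℚ.< _)
      (solve 3 (λ a b c → (a :- b) :+ (b :- c) := a :- c) refl (seq x n) (seq y n) (seq z n))
      (sum-small u v))
    (p (half-pos ε>0) ∧ᵉ q (half-pos ε>0))

  +-cong : ∀ {x y u v} → x ≈ y → u ≈ v → x + u ≈ y + v
  +-cong {x} {y} {u} {v} (null p) (null q) = null λ ε>0 → mapᵉ
    (λ n (s , t) → subst (λ r → ℚ.∣ r ∣ ℚ.< _)
      (solve 4 (λ a b c d → (a :- b) :+ (c :- d) := (a :+ c) :- (b :+ d)) refl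
        (seq x n) (seq y n) (seq u n) (seq v n))
      (sum-small s t))
    (p (half-pos ε>0) ∧ᵉ q (half-pos ε>0))

  -‿cong : ∀ {x y} → x ≈ y → - x ≈ - y
  -‿cong {x} {y} (null p) = null λ ε>0 → mapᵉ
    (λ n → subst (λ r → r ℚ.< _)
      (trans (∣-∣-swap (seq x n) (seq y n))
        (cong ℚ.∣_∣ (solve 2 (λ a b → b :- a := (:- a) :- (:- b)) refl
          (seq x n) (seq y n)))))
    (p ε>0)

  *-cong : ∀ {x y u v} → x ≈ y → u ≈ v → x * u ≈ y * v
  *-cong {x} {y} {u} {v} (null p) (null q) = null λ ε>0 →
    let B , B>0 , x-bd = eventually-bounded x
        B′ , B′>0 , v-bd = eventually-bounded v
        δ , δ>0 , Bδ = shrink B>0 (half-pos ε>0)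
        δ′ , δ′>0 , Bδ′ = shrink B′>0 (half-pos ε>0)
    in mapᵉ
      (λ n (xb , vb , uv , xy) →
        *-close (seq x n) (seq u n) (seq y n) (seq v n) B>0 B′>0 Bδ Bδ′ xb vb uv xy)
      (x-bd ∧ᵉ v-bd ∧ᵉ q δ>0 ∧ᵉ p δ′>0)

  inverseʳ : ∀ x (x#0 : x #0) → x * inverse x x#0 ≈ fromℚ 1ℚ
  inverseʳ x x#0@(_ , ε>0 , away) = eventually-≡⇒≈
    (mapᵉ (λ n → recip-inverseʳ (seq x n) ε>0) away)

open Real using (fromℚ)

ℝ-commutativeRing : CommutativeRing 0ℓ 0ℓ
ℝ-commutativeRing = record
  { Carrier = ℝ
  ; _≈_ = _≈_
  ; _+_ = _+_
  ; _*_ = _*_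
  ; -_  = -_
  ; 0#  = fromℚ 0ℚ
  ; 1#  = fromℚ 1ℚ
  ; isCommutativeRing = record
    { isRing = record
      { +-isAbelianGroup = record
        { isGroup = record
          { isMonoid = record
            { isSemigroup = record
              { isMagma = record
                { isEquivalence = record
                  { refl  = ≈-refl
                  ; sym   = ≈-sym
                  ; trans = ≈-trans
                  }
                ; ∙-cong = +-cong
                }
              ; assoc = λ x y z → ≗⇒≈
                  λ n → ℚ.+-assoc (seq x n) (seq y n) (seq z n)
              }
            ; identity =
                (λ x → ≗⇒≈ λ n → ℚ.+-identityˡ (seq x n)) ,
                (λ x → ≗⇒≈ λ n → ℚ.+-identityʳ (seq x n))
            }
          ; inverse =
              (λ x → ≗⇒≈ λ n → ℚ.+-inverseˡ (seq x n)) ,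
              (λ x → ≗⇒≈ λ n → ℚ.+-inverseʳ (seq x n))
          ; ⁻¹-cong = -‿cong
          }
        ; comm = λ x y → ≗⇒≈ λ n → ℚ.+-comm (seq x n) (seq y n)
        }
      ; *-cong = *-cong
      ; *-assoc = λ x y z → ≗⇒≈
          λ n → ℚ.*-assoc (seq x n) (seq y n) (seq z n)
      ; *-identity =
          (λ x → ≗⇒≈ λ n → ℚ.*-identityˡ (seq x n)) ,
          (λ x → ≗⇒≈ λ n → ℚ.*-identityʳ (seq x n))
      ; distrib =
          (λ x y z → ≗⇒≈
            λ n → ℚ.*-distribˡ-+ (seq x n) (seq y n) (seq z n)) ,
          (λ x y z → ≗⇒≈
            λ n → ℚ.*-distribʳ-+ (seq x n) (seq y n) (seq z n))
      }
    ; *-comm = λ x y → ≗⇒≈ λ n → ℚ.*-comm (seq x n) (seq y n)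
    }
  }
  where open Real

record ℂ : Set where
  no-eta-equality
  field
    re : ℝ
    im : ℝ

open ℂ

module Complex where

  infix  4 _≈_ _#_
  infix  5 _#0
  infixl 6 _+_ _-_
  infixl 7 _*_
  infix  8 -_

  private module R = Real

  record _≈_ (z w : ℂ) : Set where
    constructor _,_
    field
      re≈ : re z R.≈ re w
      im≈ : im z R.≈ im w

  ratio : ℚ → ℂ
  ratio q .re = fromℚ q
  ratio q .im = fromℚ 0ℚ

  0ℂ 1ℂ : ℂ
  0ℂ = ratio 0ℚ
  1ℂ = ratio 1ℚ

  _+_ : ℂ → ℂ → ℂ
  (z + w) .re = re z R.+ re w
  (z + w) .im = im z R.+ im w

  _*_ : ℂ → ℂ → ℂ
  (z * w) .re = re z R.* re w R.+ R.- (im z R.* im w)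
  (z * w) .im = re z R.* im w R.+ im z R.* re w

  -_ : ℂ → ℂ
  (- z) .re = R.- re z
  (- z) .im = R.- im z

  _-_ : ℂ → ℂ → ℂ
  z - w = z + (- w)

  ∥_∥² : ℂ → ℝ
  ∥ z ∥² = re z R.* re z R.+ im z R.* im z

  -- Division is partial, and z ≠ 0 is read positively (classically
  -- equivalently): |z|² is bounded away from 0.
  _#0 : ℂ → Set
  z #0 = ∥ z ∥² R.#0

  _#_ : ℂ → ℂ → Set
  z # w = (z - w) #0

  inverse : ∀ z → z #0 → ℂ
  inverse z z#0 .re = re z R.* R.inverse ∥ z ∥² z#0
  inverse z z#0 .im = (R.- im z) R.* R.inverse ∥ z ∥² z#0

  private
    ≗⇒≈ : ∀ {z w} → seq (re z) ≗ seq (re w) → seq (im z) ≗ seq (im w) → z ≈ w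
    ≗⇒≈ p q = R.≗⇒≈ p , R.≗⇒≈ q

    ≈-trans : ∀ {z w v} → z ≈ w → w ≈ v → z ≈ v
    ≈-trans (p , q) (p′ , q′) =
      R.≈-trans p p′ , R.≈-trans q q′

    +-cong : ∀ {z w u v} → z ≈ w → u ≈ v → z + u ≈ w + v
    +-cong (p , q) (r , s) = R.+-cong p r , R.+-cong q s

    *-cong : ∀ {z w u v} → z ≈ w → u ≈ v → z * u ≈ w * v
    *-cong (p , q) (r , s) =
      R.+-cong (R.*-cong p r) (R.-‿cong (R.*-cong q s)) ,
      R.+-cong (R.*-cong p s) (R.*-cong q r)

    *-comm : ∀ z w → z * w ≈ w * z
    *-comm z w = ≗⇒≈
      (λ n → solve 4 (λ a b c d → a :* c :+ :- (b :* d) := c :* a :+ :- (d :* b)) refl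
        (seq (re z) n) (seq (im z) n) (seq (re w) n) (seq (im w) n))
      (λ n → solve 4 (λ a b c d → a :* d :+ b :* c := c :* b :+ d :* a) refl
        (seq (re z) n) (seq (im z) n) (seq (re w) n) (seq (im w) n))

    *-identityˡ : ∀ z → 1ℂ * z ≈ z
    *-identityˡ z = ≗⇒≈
      (λ n → solve 2 (λ a b → con 1ℚ :* a :+ :- (con 0ℚ :* b) := a) refl (seq (re z) n) (seq (im z) n))
      (λ n → solve 2 (λ a b → con 1ℚ :* b :+ con 0ℚ :* a := b) refl (seq (re z) n) (seq (im z) n))

    *-distribˡ-+ : ∀ z w v → z * (w + v) ≈ z * w + z * v
    *-distribˡ-+ z w v = ≗⇒≈
      (λ n → solve 6 (λ a b c d e f →
          a :* (c :+ e) :+ :- (b :* (d :+ f))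
            := (a :* c :+ :- (b :* d)) :+ (a :* e :+ :- (b :* f))) refl
        (seq (re z) n) (seq (im z) n) (seq (re w) n) (seq (im w) n) (seq (re v) n) (seq (im v) n))
      (λ n → solve 6 (λ a b c d e f →
          a :* (d :+ f) :+ b :* (c :+ e)
            := (a :* d :+ b :* c) :+ (a :* f :+ b :* e)) refl
        (seq (re z) n) (seq (im z) n) (seq (re w) n) (seq (im w) n) (seq (re v) n) (seq (im v) n))

    *-assoc : ∀ z w v → (z * w) * v ≈ z * (w * v)
    *-assoc z w v = ≗⇒≈
      (λ n → solve 6 (λ a b c d e f →
          (a :* c :+ :- (b :* d)) :* e :+ :- ((a :* d :+ b :* c) :* f)
            := a :* (c :* e :+ :- (d :* f)) :+ :- (b :* (c :* f :+ d :* e))) refl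
        (seq (re z) n) (seq (im z) n) (seq (re w) n) (seq (im w) n) (seq (re v) n) (seq (im v) n))
      (λ n → solve 6 (λ a b c d e f →
          (a :* c :+ :- (b :* d)) :* f :+ (a :* d :+ b :* c) :* e
            := a :* (c :* f :+ d :* e) :+ b :* (c :* e :+ :- (d :* f))) refl
        (seq (re z) n) (seq (im z) n) (seq (re w) n) (seq (im w) n) (seq (re v) n) (seq (im v) n))

  inverseʳ : ∀ z (z#0 : z #0) → z * inverse z z#0 ≈ 1ℂ
  inverseʳ z z#0 =
    ≈-trans {w = w}
     (≗⇒≈
      (λ n → solve 3 (λ a b r →
          a :* (a :* r) :+ :- (b :* ((:- b) :* r)) := (a :* a :+ b :* b) :* r) refl
        (seq (re z) n) (seq (im z) n) (seq r n))
      (λ n → solve 3 (λ a b r → a :* ((:- b) :* r) :+ b :* (a :* r) := con 0ℚ) refl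
        (seq (re z) n) (seq (im z) n) (seq r n)))
     (R.inverseʳ ∥ z ∥² z#0 , R.≈-refl)
    where
    r = R.inverse ∥ z ∥² z#0
    w : ℂ
    w .re = ∥ z ∥² R.* r
    w .im = fromℚ 0ℚ

  commutativeRing : CommutativeRing 0ℓ 0ℓ
  commutativeRing = record
    { Carrier = ℂ
    ; _≈_ = _≈_
    ; _+_ = _+_
    ; _*_ = _*_
    ; -_  = -_
    ; 0#  = 0ℂ
    ; 1#  = 1ℂ
    ; isCommutativeRing = record
      { isRing = record
        { +-isAbelianGroup = record
          { isGroup = record
            { isMonoid = record
              { isSemigroup = record
                { isMagma = record
                  { isEquivalence = record
                    { refl  = R.≈-refl , R.≈-refl
                    ; sym   = λ (p , q) → R.≈-sym p , R.≈-sym q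
                    ; trans = ≈-trans
                    }
                  ; ∙-cong = +-cong
                  }
                ; assoc = λ z w v →
                    ℝᵣ.+-assoc (re z) (re w) (re v) , ℝᵣ.+-assoc (im z) (im w) (im v)
                }
              ; identity =
                  (λ z → ℝᵣ.+-identityˡ (re z) , ℝᵣ.+-identityˡ (im z)) ,
                  (λ z → ℝᵣ.+-identityʳ (re z) , ℝᵣ.+-identityʳ (im z))
              }
            ; inverse =
                (λ z → ℝᵣ.-‿inverseˡ (re z) , ℝᵣ.-‿inverseˡ (im z)) ,
                (λ z → ℝᵣ.-‿inverseʳ (re z) , ℝᵣ.-‿inverseʳ (im z))
            ; ⁻¹-cong = λ (p , q) → R.-‿cong p , R.-‿cong q
            }
          ; comm = λ z w → ℝᵣ.+-comm (re z) (re w) , ℝᵣ.+-comm (im z) (im w)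
          }
        ; *-cong = *-cong
        ; *-assoc = *-assoc
        ; *-identity = *-identityˡ , λ z → ≈-trans (*-comm z 1ℂ) (*-identityˡ z)
        ; distrib = *-distribˡ-+ , distribʳ
        }
      ; *-comm = *-comm
      }
    }
    where
    module ℝᵣ = CommutativeRing ℝ-commutativeRing
    distribʳ : ∀ z w v → (w + v) * z ≈ w * z + v * z
    distribʳ z w v = ≈-trans (*-comm (w + v) z)
      (≈-trans (*-distribˡ-+ z w v) (+-cong (*-comm z w) (*-comm z v)))

  open RawSemiringDefinitions (Semiring.rawSemiring (CommutativeRing.semiring commutativeRing)) public
    using (_^_)

  ∑ ∏ : List ℂ → ℂ
  ∑ = foldr _+_ 0ℂ
  ∏ = foldr _*_ 1ℂ

open Complex

ℂˣ : Set
ℂˣ = ∃[ z ] z #0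

ℂˣ-setoid : Setoid 0ℓ 0ℓ
ℂˣ-setoid = On.setoid (CommutativeRing.setoid commutativeRing) (proj₁ {B = _#0})

infixr 8 _^ᶻ_ _^ᵐ_

_^ᶻ_ : ℂˣ → ℤ → ℂ
(z , _)   ^ᶻ (+ k)    = z ^ k
(z , z#0) ^ᶻ -[1+ k ] = inverse z z#0 ^ suc k

ℤ² : Set
ℤ² = ℤ × ℤ

-ᵛ_ : ℤ² → ℤ²
-ᵛ (a , b) = ℤ.- a , ℤ.- b

Torus : Set
Torus = ℂˣ × ℂˣ

Torus-setoid : Setoid 0ℓ 0ℓ
Torus-setoid = ×-setoid ℂˣ-setoid ℂˣ-setoid

_^ᵐ_ : Torus → ℤ² → ℂ
(θ₁ , θ₂) ^ᵐ (a₁ , a₂) = θ₁ ^ᶻ a₁ * θ₂ ^ᶻ a₂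

_≠e : Torus → Set
((θ₁ , _) , (θ₂ , _)) ≠e = θ₁ # 1ℂ ⊎ θ₂ # 1ℂ

-- A listing without repetition of the finite set { x ∣ P x }, used to sum
-- over that set.
record Enumeration (S : Setoid 0ℓ 0ℓ) (P : Setoid.Carrier S → Set) : Set where
  open Membership S using (_∈_)
  open Uniqueness S using (Unique)
  field
    elements : List (Setoid.Carrier S)
    unique   : Unique elements
    sound    : All P elements
    complete : ∀ x → P x → x ∈ elements

open Enumeration public using (elements)

NontrivialRoot : ℕ → ℂˣ → Set
NontrivialRoot N z = z ^ᶻ (+ N) ≈ 1ℂ × proj₁ z # 1ℂ

NontrivialRoots : ℕ → Set
NontrivialRoots N = Enumeration ℂˣ-setoid (NontrivialRoot N)

σ-denominator : List ℤ → ℂˣ → ℂ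
σ-denominator C z = ∏ (map (λ c → z ^ᶻ c - 1ℂ) C)

σ-Defined : (C : List ℤ) (N : ℕ) → NontrivialRoots N → Set
σ-Defined C N Λ = All (λ z → σ-denominator C z #0) (elements Λ)

-- The value does not depend on the enumeration Λ, nor on the evidence that the
-- denominators are nonzero.
σ : (t : ℤ) (C : List ℤ) (N : ℕ) .{{_ : ℕ.NonZero N}} (Λ : NontrivialRoots N) →
    σ-Defined C N Λ → ℂ
σ t C N Λ defined =
  ratio (1ℤ ℚ./ N) * ∑ (reduce (λ {z} d#0 → z ^ᶻ t * inverse (σ-denominator C z) d#0) defined)

Matrix : ℕ → Set
Matrix n = Vector ℤ² n

module _ {n} (M : Matrix n) where

  x y : Fin n → ℤ
  x = proj₁ ∘ M
  y = proj₂ ∘ M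

  Y : Fin n → Fin n → ℤ
  Y a b = x a ℤ.* y b ℤ.- x b ℤ.* y a

  SlopeOrdered : Set
  SlopeOrdered = ∀ {a b} → a Fin.< b → 0ℤ ℤ.< Y a b

  Spanning : Fin n → Fin n → Fin n → Set
  Spanning a b c = ∀ u v → ∃[ α ] ∃[ β ] ∃[ γ ]
    (α R.* real (x a) R.+ β R.* real (x b) R.+ γ R.* real (x c) R.≈ u) ×
    (α R.* real (y a) R.+ β R.* real (y b) R.+ γ R.* real (y c) R.≈ v)
    where
    module R = Real
    real : ℤ → ℝ
    real k = fromℚ (k ℚ./ 1)

  nonzeroMinors : Fin n → Fin n → Fin n → List ℕ
  nonzeroMinors a b c =
    filter (λ k → ¬? (k ℕ.≟ 0)) (map ℤ.∣_∣ (Y a b ∷ Y a c ∷ Y b c ∷ []))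

  OnePrime : Set
  OnePrime = ∀ a b c → a ≢ b → a ≢ c → b ≢ c → Spanning a b c →
    foldr ℕ.gcd 0 (nonzeroMinors a b c) ≡ 1

  module _ (i j : Fin n) where

    others : List (Fin n)
    others = filter (λ h → ¬? (h Fin.≟ i) ×-dec ¬? (h Fin.≟ j)) (allFin n)

    NontrivialSolution : Torus → Set
    NontrivialSolution θ = (θ ^ᵐ M i ≈ 1ℂ × θ ^ᵐ M j ≈ 1ℂ) × θ ≠e

    NontrivialSolutions : Set
    NontrivialSolutions = Enumeration Torus-setoid NontrivialSolution

    FactorsNonzero : Torus → Set
    FactorsNonzero θ = All (λ ω → (1ℂ - θ ^ᵐ (-ᵛ ω)) #0) (map M others)

    summand : ℤ² → (θ : Torus) → FactorsNonzero θ → ℂ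
    summand 𝐧 θ nz = θ ^ᵐ 𝐧 * ∏ (reduce (λ {ω} → inverse (1ℂ - θ ^ᵐ (-ᵛ ω))) nz)

    SolutionSumDefined : NontrivialSolutions → Set
    SolutionSumDefined Θ = All FactorsNonzero (elements Θ)

    solutionSum : ℤ² → (Θ : NontrivialSolutions) → SolutionSumDefined Θ → ℂ
    solutionSum 𝐧 Θ defined = ∑ (reduce (λ {θ} → summand 𝐧 θ) defined)

{-# OPTIONS --safe #-}
module Submission where

-- Write M_a for the columns, N = Y_ij, s = f M_i + g M_j and W = det(s, M_m), so
-- that u W ≡ 1 mod N.  A solution θ and a root λ with λ^N = 1 correspond when
-- θ^a = λ^(u det(s, a)) for all a ∈ ℤ².  Each λ defines such a θ, and λ = θ^(M_m)
-- recovers the root.  Conversely every solution arises from λ = θ^(M_m): the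
-- relation det(s, M_m) a = det(a, M_m) s + det(s, a) M_m gives
-- θ^(W a) = λ^det(s, a), and θ^a has order dividing N.  Under the correspondence
-- θ^(M_h) = λ^c for the element c = u det(s, M_h) of C, and
-- 1/(1 - λ^(-c)) = λ^c/(λ^c - 1) matches the two sums term by term.
--
-- That the denominators do not vanish is where 1-primality enters: any a is an
-- integer combination of M_i, M_j, M_h, since det(v, w) a is one of v and w and
-- the three minors have gcd 1.  Hence θ^a is a power of θ^(M_h), and θ^(M_h) ≠ 1.

open import Defs
open import Algebra.Bundles using (CommutativeRing)
import Algebra.Properties.CommutativeSemigroup as CommutativeSemigroupProperties
import Algebra.Properties.Ring as RingProperties
import Algebra.Properties.Semiring.Exp as Exp
import Algebra.Solver.Ring.NaturalCoefficients.Default as SemiringSolver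
open import Data.Fin.Base as Fin using (Fin)
import Data.Fin.Properties as Fin
open import Data.Integer.Base as ℤ using (ℤ; +_; -[1+_]; -_; 0ℤ; 1ℤ; ∣_∣)
open import Data.Integer.Divisibility using (_∣_)
import Data.Integer.Divisibility.Signed as Signed
open import Data.Integer.GCD using (gcd)
import Data.Integer.Properties as ℤ
import Data.Integer.Solver as ℤ
open import Data.List.Base using (List; []; _∷_; map; foldr; allFin)
open import Data.List.Relation.Unary.All as All using (All; []; _∷_; reduce)
import Data.List.Relation.Unary.All.Properties as All
open import Data.List.Relation.Unary.AllPairs as AllPairs using (AllPairs; []; _∷_)
import Data.List.Relation.Unary.AllPairs.Properties as AllPairs
open import Data.List.Relation.Unary.Any as Any using (Any; here; there; _─_)
import Data.List.Relation.Unary.Any.Properties as Any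
open import Data.Nat.Base as ℕ using (ℕ; zero; suc)
import Data.Nat.GCD as ℕ
import Data.Nat.Properties as ℕ
open import Data.Product.Base using (Σ-syntax; ∃; ∃-syntax; _×_; _,_; proj₁; proj₂)
open import Data.Rational.Base as ℚ using (ℚ; 0ℚ; 1ℚ; ½)
import Data.Rational.Properties as ℚ
import Data.Rational.Solver as ℚ
import Data.Rational.Unnormalised.Base as ℚᵘ
import Data.Rational.Unnormalised.Properties as ℚᵘ
open import Data.Sum.Base as Sum using (_⊎_; inj₁; inj₂; [_,_])
open import Function.Base using (_∘_)
open import Level using (0ℓ)
open import Relation.Binary.Bundles using (Setoid)
open import Relation.Binary.PropositionalEquality as ≡ using (_≡_; _≢_)
import Relation.Binary.Reasoning.Setoid as SetoidReasoning
open import Relation.Nullary.Decidable using (¬?; _×-dec_)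
open import Relation.Nullary.Negation using (¬_; contradiction)

open ℝ using (seq; cauchy)
open ℂ using (re; im)
open Complex hiding (-_)

-- ℂ is a local ring whose units are the z with z #0

module _ where
  open ℚ.+-*-Solver using (solve; con; _:+_; _:*_; :-_; _:-_; _:=_)
  open ℚ.≤-Reasoning

  p≤∣p∣ : ∀ p → p ℚ.≤ ℚ.∣ p ∣
  p≤∣p∣ p with ℚ.≤-total 0ℚ p
  ... | inj₁ 0≤p = ℚ.≤-reflexive (≡.sym (ℚ.0≤p⇒∣p∣≡p 0≤p))
  ... | inj₂ p≤0 = ℚ.≤-trans p≤0 (ℚ.0≤∣p∣ p)

  0≤p² : ∀ p → 0ℚ ℚ.≤ p ℚ.* p
  0≤p² p with ℚ.≤-total 0ℚ p
  ... | inj₁ 0≤p = begin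
    0ℚ          ≡⟨ ℚ.*-zeroˡ p ⟨
    0ℚ ℚ.* p    ≤⟨ ℚ.*-monoʳ-≤-nonNeg p {{ℚ.nonNegative 0≤p}} 0≤p ⟩
    p ℚ.* p     ∎
  ... | inj₂ p≤0 = begin
    0ℚ          ≡⟨ ℚ.*-zeroˡ p ⟨
    0ℚ ℚ.* p    ≤⟨ ℚ.*-monoʳ-≤-nonPos p {{ℚ.nonPositive p≤0}} p≤0 ⟩
    p ℚ.* p     ∎

  ∣q-p∣≡∣p-q∣ : ∀ p q → ℚ.∣ q ℚ.- p ∣ ≡ ℚ.∣ p ℚ.- q ∣
  ∣q-p∣≡∣p-q∣ p q = ≡.trans
    (≡.cong ℚ.∣_∣ (solve 2 (λ p q → q :- p := :- (p :- q)) ≡.refl p q))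
    (ℚ.∣-p∣≡∣p∣ (p ℚ.- q))

  ∣p-q∣<ε⇒q-ε<p : ∀ p q ε → ℚ.∣ p ℚ.- q ∣ ℚ.< ε → q ℚ.- ε ℚ.< p
  ∣p-q∣<ε⇒q-ε<p p q ε h = begin-strict
    q ℚ.- ε                            ≡⟨ solve 3 (λ p q ε → q :- ε := (p :- ε) :+ (q :- p)) ≡.refl p q ε ⟩
    (p ℚ.- ε) ℚ.+ (q ℚ.- p)            ≤⟨ ℚ.+-monoʳ-≤ (p ℚ.- ε) (p≤∣p∣ (q ℚ.- p)) ⟩
    (p ℚ.- ε) ℚ.+ ℚ.∣ q ℚ.- p ∣        ≡⟨ ≡.cong ((p ℚ.- ε) ℚ.+_) (∣q-p∣≡∣p-q∣ p q) ⟩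
    (p ℚ.- ε) ℚ.+ ℚ.∣ p ℚ.- q ∣        <⟨ ℚ.+-monoʳ-< (p ℚ.- ε) h ⟩
    (p ℚ.- ε) ℚ.+ ε                    ≡⟨ solve 2 (λ p ε → (p :- ε) :+ ε := p) ≡.refl p ε ⟩
    p                                  ∎

  module _ (B : ℚ) (B>0 : 0ℚ ℚ.< B) where
    instance
      B+ = ℚ.positive B>0
      B≢0 = ℚ.pos⇒nonZero B

    ½/ : ℚ
    ½/ = ½ ℚ.* ℚ.1/ B

    ½/-positive : 0ℚ ℚ.< ½/
    ½/-positive = ℚ.positive⁻¹ ½/ {{ℚ.pos*pos⇒pos ½ (ℚ.1/ B) {{ℚ.1/pos⇒pos B}}}}

    ½/≤ : ∀ p q → ℚ.∣ q ∣ ℚ.≤ B → ℚ.∣ p ℚ.* q ℚ.- 1ℚ ∣ ℚ.< ½ → ½/ ℚ.≤ ℚ.∣ p ∣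
    ½/≤ p q q≤ close = ℚ.*-cancelʳ-≤-pos B (begin
      ½/ ℚ.* B               ≡⟨ ℚ.*-assoc ½ (ℚ.1/ B) B ⟩
      ½ ℚ.* (ℚ.1/ B ℚ.* B)   ≡⟨ ≡.cong (½ ℚ.*_) (ℚ.*-inverseˡ B) ⟩
      ½ ℚ.* 1ℚ               ≡⟨⟩
      1ℚ ℚ.- ½               ≤⟨ ℚ.<⇒≤ (∣p-q∣<ε⇒q-ε<p (p ℚ.* q) 1ℚ ½ close) ⟩
      p ℚ.* q                ≤⟨ p≤∣p∣ (p ℚ.* q) ⟩
      ℚ.∣ p ℚ.* q ∣          ≡⟨ ℚ.∣p*q∣≡∣p∣*∣q∣ p q ⟩
      ℚ.∣ p ∣ ℚ.* ℚ.∣ q ∣    ≤⟨ ℚ.*-monoˡ-≤-nonNeg ℚ.∣ p ∣ {{ℚ.∣-∣-nonNeg p}} q≤ ⟩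
      ℚ.∣ p ∣ ℚ.* B          ∎)

  ¼ ⅛ : ℚ
  ¼ = ½ ℚ.* ½
  ⅛ = ½ ℚ.* ¼

  ¼≤ : ∀ p q → ½ ℚ.≤ q → ℚ.∣ p ℚ.- q ∣ ℚ.< ¼ → ¼ ℚ.≤ ℚ.∣ p ∣
  ¼≤ p q ½≤q close = begin
    ¼          ≡⟨⟩
    ½ ℚ.- ¼    ≤⟨ ℚ.+-monoˡ-≤ (ℚ.- ¼) ½≤q ⟩
    q ℚ.- ¼    ≤⟨ ℚ.<⇒≤ (∣p-q∣<ε⇒q-ε<p p q ¼ close) ⟩
    p          ≤⟨ p≤∣p∣ p ⟩
    ℚ.∣ p ∣    ∎

  ⅛≤ : ∀ p q r → r ℚ.≤ ½ → ℚ.∣ r ℚ.- p ∣ ℚ.< ¼ → ℚ.∣ (p ℚ.+ q) ℚ.- 1ℚ ∣ ℚ.< ⅛ → ⅛ ℚ.≤ ℚ.∣ q ∣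
  ⅛≤ p q r r≤½ r-close s-close = begin
    ⅛                            ≡⟨⟩
    (1ℚ ℚ.- ⅛) ℚ.- (½ ℚ.+ ¼)     ≤⟨ ℚ.+-mono-≤ (ℚ.<⇒≤ (∣p-q∣<ε⇒q-ε<p (p ℚ.+ q) 1ℚ ⅛ s-close)) (ℚ.neg-antimono-≤ p≤) ⟩
    (p ℚ.+ q) ℚ.- p              ≡⟨ solve 2 (λ a b → (a :+ b) :- a := b) ≡.refl p q ⟩
    q                            ≤⟨ p≤∣p∣ q ⟩
    ℚ.∣ q ∣                      ∎
    where
    p≤ : p ℚ.≤ ½ ℚ.+ ¼
    p≤ = begin
      p                   ≡⟨ solve 2 (λ a b → a := (a :- b) :+ b) ≡.refl p ¼ ⟩
      (p ℚ.- ¼) ℚ.+ ¼     ≤⟨ ℚ.+-monoˡ-≤ ¼ (ℚ.<⇒≤ (∣p-q∣<ε⇒q-ε<p r p ¼ r-close)) ⟩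
      r ℚ.+ ¼             ≤⟨ ℚ.+-monoˡ-≤ ¼ r≤½ ⟩
      ½ ℚ.+ ¼             ∎

  -- Once |y| ≤ B and xy is within ½ of 1, |x| is at least 1/(2B).
  x*y≈1⇒x#0 : ∀ x y → x Real.* y Real.≈ Real.fromℚ 1ℚ → x Real.#0
  x*y≈1⇒x#0 x y (Real.null xy≈1) =
    let B , B>0 , y≤B = Real.eventually-bounded y
    in ½/ B B>0 , ½/-positive B B>0 , mapᵉ
      (λ n (y≤ , close) → ½/≤ B B>0 (seq x n) (seq y n) y≤ close)
      (y≤B ∧ᵉ xy≈1 (ℚ.positive⁻¹ ½))

  -- One rational comparison decides. From index N on, x varies by less than ¼, so x_N ≥ ½ keeps x
  -- above ¼. Otherwise x is below ¾, and x + y > 7/8 leaves at least ⅛ for y.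
  x+y≈1⇒x#0⊎y#0 : ∀ x y → x Real.+ y Real.≈ Real.fromℚ 1ℚ → x Real.#0 ⊎ y Real.#0
  x+y≈1⇒x#0⊎y#0 x y (Real.null x+y≈1) with cauchy x (ℚ.positive⁻¹ ¼)
  ... | N , close with ℚ.≤-total ½ (seq x N)
  ...   | inj₁ ½≤ = inj₁ (¼ , ℚ.positive⁻¹ ¼ , N , λ n N≤n →
          ¼≤ (seq x n) (seq x N) ½≤ (close n N N≤n ℕ.≤-refl))
  ...   | inj₂ ≤½ = inj₂ (⅛ , ℚ.positive⁻¹ ⅛ , mapᵉ
          (λ n (x-close , s-close) → ⅛≤ (seq x n) (seq y n) (seq x N) ≤½ x-close s-close)
          ((N , λ n N≤n → close N n ℕ.≤-refl N≤n) ∧ᵉ x+y≈1 (ℚ.positive⁻¹ ⅛)))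

  re#0⇒#0 : ∀ z → re z Real.#0 → z #0
  re#0⇒#0 z (ε , ε>0 , away) = ε ℚ.* ε , ε²>0 , mapᵉ bound away
    where
    ε+ = ℚ.positive ε>0
    ε²>0 = ℚ.positive⁻¹ (ε ℚ.* ε) {{ℚ.pos*pos⇒pos ε {{ε+}} ε {{ε+}}}}
    bound : ∀ n → ε ℚ.≤ ℚ.∣ seq (re z) n ∣ → ε ℚ.* ε ℚ.≤ ℚ.∣ seq ∥ z ∥² n ∣
    bound n ε≤ = begin
      ε ℚ.* ε                            ≤⟨ ℚ.*-monoʳ-≤-nonNeg ε {{ℚ.pos⇒nonNeg ε {{ε+}}}} ε≤ ⟩
      ℚ.∣ a ∣ ℚ.* ε                      ≤⟨ ℚ.*-monoˡ-≤-nonNeg ℚ.∣ a ∣ {{ℚ.∣-∣-nonNeg a}} ε≤ ⟩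
      ℚ.∣ a ∣ ℚ.* ℚ.∣ a ∣                ≡⟨ ℚ.∣p*q∣≡∣p∣*∣q∣ a a ⟨
      ℚ.∣ a ℚ.* a ∣                      ≡⟨ ℚ.0≤p⇒∣p∣≡p (0≤p² a) ⟩
      a ℚ.* a                            ≡⟨ ℚ.+-identityʳ (a ℚ.* a) ⟨
      a ℚ.* a ℚ.+ 0ℚ                     ≤⟨ ℚ.+-monoʳ-≤ (a ℚ.* a) (0≤p² b) ⟩
      a ℚ.* a ℚ.+ b ℚ.* b                ≤⟨ p≤∣p∣ (a ℚ.* a ℚ.+ b ℚ.* b) ⟩
      ℚ.∣ a ℚ.* a ℚ.+ b ℚ.* b ∣          ∎
      where
      a = seq (re z) n
      b = seq (im z) n

  ∥∥²-* : ∀ z w → ∥ z ∥² Real.* ∥ w ∥² Real.≈ ∥ z * w ∥²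
  ∥∥²-* z w = Real.≗⇒≈ λ n →
    solve 4 (λ a b c d → (a :* a :+ b :* b) :* (c :* c :+ d :* d) :=
        (a :* c :+ :- (b :* d)) :* (a :* c :+ :- (b :* d)) :+ (a :* d :+ b :* c) :* (a :* d :+ b :* c)) ≡.refl
      (seq (re z) n) (seq (im z) n) (seq (re w) n) (seq (im w) n)

-- The squared norm is multiplicative, so ∥ w ∥² inverts ∥ z ∥². Nonvanishing is obtained below by
-- exhibiting an inverse.
unit⇒#0 : ∀ z w → z * w ≈ 1ℂ → z #0
unit⇒#0 z w (re≈ , im≈) = x*y≈1⇒x#0 ∥ z ∥² ∥ w ∥²
  (Real.≈-trans (∥∥²-* z w)
    (Real.≈-trans (Real.+-cong (Real.*-cong re≈ re≈) (Real.*-cong im≈ im≈)) (Real.≗⇒≈ λ _ → ≡.refl)))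

-- Integers as rationals, and spanning triples of columns

ι : ℤ → ℚ
ι k = k ℚ./ 1

-- `ℚ./` normalises its result, so the proof passes to unnormalised fractions, where products with
-- denominator 1 compute.
ι-homo-* : ∀ a b → ι a ℚ.* ι b ≡ ι (a ℤ.* b)
ι-homo-* a b = ℚ.toℚᵘ-injective (begin
  ℚ.toℚᵘ (ι a ℚ.* ι b)               ≈⟨ ℚ.toℚᵘ-homo-* (ι a) (ι b) ⟩
  ℚ.toℚᵘ (ι a) ℚᵘ.* ℚ.toℚᵘ (ι b)     ≈⟨ ℚᵘ.*-cong (ℚ.toℚᵘ-fromℚᵘ (ℚᵘ.mkℚᵘ a 0)) (ℚ.toℚᵘ-fromℚᵘ (ℚᵘ.mkℚᵘ b 0)) ⟩
  ℚᵘ.mkℚᵘ (a ℤ.* b) 0                ≈⟨ ℚ.toℚᵘ-fromℚᵘ (ℚᵘ.mkℚᵘ (a ℤ.* b) 0) ⟨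
  ℚ.toℚᵘ (ι (a ℤ.* b))               ∎)
  where open SetoidReasoning ℚᵘ.≃-setoid

ι-injective : ∀ a b → ι a ≡ ι b → a ≡ b
ι-injective a b eq with ℚ.fromℚᵘ-injective {ℚᵘ.mkℚᵘ a 0} {ℚᵘ.mkℚᵘ b 0} eq
... | ℚᵘ.*≡* a*1≡b*1 = ℤ.*-cancelʳ-≡ a b 1ℤ a*1≡b*1

module _ {n} (M : Matrix n) where

  -- Cramer's rule for the columns a and b; column c gets the coefficient 0.
  independent⇒Spanning : ∀ {a b} → Y M a b ≢ 0ℤ → ∀ c → Spanning M a b c
  independent⇒Spanning {a} {b} Y≢0 c u v =
    (u R.* fromℚ yb R.+ R.- (v R.* fromℚ xb)) R.* fromℚ (ℚ.1/ D) ,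
    (v R.* fromℚ xa R.+ R.- (u R.* fromℚ ya)) R.* fromℚ (ℚ.1/ D) ,
    fromℚ 0ℚ ,
    R.≗⇒≈ (λ k → ≡.trans
      (solve 8 (λ u v xa ya xb yb xc r →
        (u :* yb :+ :- (v :* xb)) :* r :* xa :+ (v :* xa :+ :- (u :* ya)) :* r :* xb :+ con 0ℚ :* xc
          := u :* ((xa :* yb :- xb :* ya) :* r)) ≡.refl
        (seq u k) (seq v k) xa ya xb yb (ι (x M c)) (ℚ.1/ D))
      (cancel (seq u k))) ,
    R.≗⇒≈ (λ k → ≡.trans
      (solve 8 (λ u v xa ya xb yb yc r →
        (u :* yb :+ :- (v :* xb)) :* r :* ya :+ (v :* xa :+ :- (u :* ya)) :* r :* yb :+ con 0ℚ :* yc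
          := v :* ((xa :* yb :- xb :* ya) :* r)) ≡.refl
        (seq u k) (seq v k) xa ya xb yb (ι (y M c)) (ℚ.1/ D))
      (cancel (seq v k)))
    where
    module R = Real
    open R using (fromℚ)
    open ℚ.+-*-Solver using (solve; con; _:+_; _:*_; :-_; _:-_; _:=_)
    xa = ι (x M a)
    ya = ι (y M a)
    xb = ι (x M b)
    yb = ι (y M b)
    D = xa ℚ.* yb ℚ.- xb ℚ.* ya
    D≢0 : D ≢ 0ℚ
    D≢0 D≡0 = Y≢0 (ℤ.i≡j⇒i-j≡0 (ι-injective (x M a ℤ.* y M b) (x M b ℤ.* y M a) (begin
      ι (x M a ℤ.* y M b)               ≡⟨ ι-homo-* (x M a) (y M b) ⟨
      xa ℚ.* yb                         ≡⟨ solve 2 (λ p q → p := (p :- q) :+ q) ≡.refl (xa ℚ.* yb) (xb ℚ.* ya) ⟩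
      D ℚ.+ xb ℚ.* ya                   ≡⟨ ≡.cong (ℚ._+ xb ℚ.* ya) D≡0 ⟩
      0ℚ ℚ.+ xb ℚ.* ya                  ≡⟨ ℚ.+-identityˡ (xb ℚ.* ya) ⟩
      xb ℚ.* ya                         ≡⟨ ι-homo-* (x M b) (y M a) ⟩
      ι (x M b ℤ.* y M a)               ∎)))
      where open ≡.≡-Reasoning
    instance D≠0 = ℚ.≢-nonZero D≢0
    cancel : ∀ p → p ℚ.* (D ℚ.* ℚ.1/ D) ≡ p
    cancel p = ≡.trans (≡.cong (p ℚ.*_) (ℚ.*-inverseʳ D)) (ℚ.*-identityʳ p)

-- Locality of ℂ and cancellation of units

open CommutativeRing commutativeRing hiding (_+_; _*_; -_; _-_; _≈_; zero)
open CommutativeSemigroupProperties *-commutativeSemigroup using (interchange)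
open RingProperties ring using (-‿distribˡ-*; -‿distribʳ-*)
open Exp semiring using (^-homo-*)
open SetoidReasoning setoid

z*w#0⇒z#0 : ∀ z w → (z * w) #0 → z #0
z*w#0⇒z#0 z w zw#0 = unit⇒#0 z (w * inverse (z * w) zw#0)
  (trans (sym (*-assoc z w _)) (inverseʳ (z * w) zw#0))

#0-resp-≈ : ∀ {z w} → z ≈ w → z #0 → w #0
#0-resp-≈ {z} {w} z≈w z#0 = unit⇒#0 w (inverse z z#0)
  (trans (*-congʳ (sym z≈w)) (inverseʳ z z#0))

-- Dividing by z + w gives two numbers with sum 1. Their real parts also have sum 1, so the real
-- case applies.
z+w#0⇒z#0⊎w#0 : ∀ z w → (z + w) #0 → z #0 ⊎ w #0
z+w#0⇒z#0⊎w#0 z w z+w#0 = Sum.map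
  (λ re#0 → z*w#0⇒z#0 z v (re#0⇒#0 (z * v) re#0))
  (λ re#0 → z*w#0⇒z#0 w v (re#0⇒#0 (w * v) re#0))
  (x+y≈1⇒x#0⊎y#0 (re (z * v)) (re (w * v)) (_≈_.re≈ zv+wv≈1))
  where
  v = inverse (z + w) z+w#0
  zv+wv≈1 : z * v + w * v ≈ 1ℂ
  zv+wv≈1 = trans (sym (distribʳ v z w)) (inverseʳ (z + w) z+w#0)

module _ {z z′ : ℂ} (zz′≈1 : z * z′ ≈ 1ℂ) where

  ^-inverse : ∀ n → z ^ n * z′ ^ n ≈ 1ℂ
  ^-inverse zero    = *-identityˡ 1ℂ
  ^-inverse (suc n) = begin
    (z * z ^ n) * (z′ * z′ ^ n)   ≈⟨ interchange z (z ^ n) z′ (z′ ^ n) ⟩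
    (z * z′) * (z ^ n * z′ ^ n)   ≈⟨ *-cong zz′≈1 (^-inverse n) ⟩
    1ℂ * 1ℂ                       ≈⟨ *-identityˡ 1ℂ ⟩
    1ℂ                            ∎

  *-cancelˡ-unit : ∀ {v w} → z * v ≈ z * w → v ≈ w
  *-cancelˡ-unit {v} {w} zv≈zw = begin
    v              ≈⟨ z′[zv]≈v v ⟨
    z′ * (z * v)   ≈⟨ *-congˡ zv≈zw ⟩
    z′ * (z * w)   ≈⟨ z′[zv]≈v w ⟩
    w              ∎
    where
    z′[zv]≈v : ∀ v → z′ * (z * v) ≈ v
    z′[zv]≈v v = begin
      z′ * (z * v)   ≈⟨ *-assoc z′ z v ⟨
      (z′ * z) * v   ≈⟨ *-congʳ (trans (*-comm z′ z) zz′≈1) ⟩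
      1ℂ * v         ≈⟨ *-identityˡ v ⟩
      v              ∎

-- Integer powers

^ᶻ-⊖ : ∀ z m n → z ^ᶻ (m ℤ.⊖ n) ≈ proj₁ z ^ m * inverse (proj₁ z) (proj₂ z) ^ n
^ᶻ-⊖ z zero    zero    = sym (*-identityˡ 1ℂ)
^ᶻ-⊖ z (suc m) zero    = sym (*-identityʳ _)
^ᶻ-⊖ z zero    (suc n) = sym (*-identityˡ _)
^ᶻ-⊖ (z , z#0) (suc m) (suc n) = begin
  (z , z#0) ^ᶻ (suc m ℤ.⊖ suc n)    ≡⟨ ≡.cong ((z , z#0) ^ᶻ_) (ℤ.[1+m]⊖[1+n]≡m⊖n m n) ⟩
  (z , z#0) ^ᶻ (m ℤ.⊖ n)            ≈⟨ ^ᶻ-⊖ (z , z#0) m n ⟩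
  z ^ m * z⁻¹ ^ n                   ≈⟨ *-identityˡ _ ⟨
  1ℂ * (z ^ m * z⁻¹ ^ n)            ≈⟨ *-congʳ (inverseʳ z z#0) ⟨
  (z * z⁻¹) * (z ^ m * z⁻¹ ^ n)     ≈⟨ interchange z z⁻¹ (z ^ m) (z⁻¹ ^ n) ⟩
  (z * z ^ m) * (z⁻¹ * z⁻¹ ^ n)     ∎
  where z⁻¹ = inverse z z#0

^ᶻ-homo-+ : ∀ z a b → z ^ᶻ (a ℤ.+ b) ≈ z ^ᶻ a * z ^ᶻ b
^ᶻ-homo-+ z (+ m)    (+ n)    = ^-homo-* (proj₁ z) m n
^ᶻ-homo-+ z (+ m)    -[1+ n ] = ^ᶻ-⊖ z m (suc n)
^ᶻ-homo-+ z -[1+ m ] (+ n)    = trans (^ᶻ-⊖ z n (suc m)) (*-comm _ _)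
^ᶻ-homo-+ (z , z#0) -[1+ m ] -[1+ n ] = begin
  z⁻¹ ^ suc (suc (m ℕ.+ n))     ≡⟨ ≡.cong (λ k → z⁻¹ ^ suc k) (ℕ.+-suc m n) ⟨
  z⁻¹ ^ (suc m ℕ.+ suc n)       ≈⟨ ^-homo-* z⁻¹ (suc m) (suc n) ⟩
  z⁻¹ ^ suc m * z⁻¹ ^ suc n     ∎
  where z⁻¹ = inverse z z#0

record Homomorphism (h : ℤ → ℂ) : Set where
  field
    homo-0 : h 0ℤ ≈ 1ℂ
    homo-+ : ∀ a b → h (a ℤ.+ b) ≈ h a * h b

  homo-- : ∀ a → h a * h (ℤ.- a) ≈ 1ℂ
  homo-- a = begin
    h a * h (ℤ.- a)   ≈⟨ homo-+ a (ℤ.- a) ⟨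
    h (a ℤ.- a)       ≡⟨ ≡.cong h (ℤ.+-inverseʳ a) ⟩
    h 0ℤ              ≈⟨ homo-0 ⟩
    1ℂ                ∎

open Homomorphism

^ᶻ-homomorphism : ∀ z → Homomorphism (z ^ᶻ_)
^ᶻ-homomorphism z = record { homo-0 = refl ; homo-+ = ^ᶻ-homo-+ z }

-- A homomorphism from ℤ is determined by its value at 1; negative exponents follow by cancelling
-- the unit h(n + 1). The power laws below are instances, which avoids case distinctions on signs.
^ᶻ-unique : ∀ {h} → Homomorphism h → ∀ z → proj₁ z ≈ h 1ℤ → ∀ a → z ^ᶻ a ≈ h a
^ᶻ-unique {h} H (z , z#0) z≈h1 = unique
  where
  unique-+ : ∀ n → z ^ n ≈ h (+ n)
  unique-+ zero    = sym (homo-0 H)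
  unique-+ (suc n) = begin
    z * z ^ n        ≈⟨ *-cong z≈h1 (unique-+ n) ⟩
    h 1ℤ * h (+ n)   ≈⟨ homo-+ H 1ℤ (+ n) ⟨
    h (+ suc n)      ∎

  unique : ∀ a → (z , z#0) ^ᶻ a ≈ h a
  unique (+ n)    = unique-+ n
  unique -[1+ n ] = *-cancelˡ-unit (homo-- H (+ suc n)) (begin
    h (+ suc n) * inverse z z#0 ^ suc n   ≈⟨ *-congʳ (unique-+ (suc n)) ⟨
    z ^ suc n * inverse z z#0 ^ suc n     ≈⟨ ^-inverse (inverseʳ z z#0) (suc n) ⟩
    1ℂ                                    ≈⟨ homo-- H (+ suc n) ⟨
    h (+ suc n) * h -[1+ n ]              ∎)

^ᶻ-congˡ : ∀ z w → proj₁ z ≈ proj₁ w → ∀ a → z ^ᶻ a ≈ w ^ᶻ a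
^ᶻ-congˡ z w z≈w = ^ᶻ-unique (^ᶻ-homomorphism w) z (trans z≈w (sym (*-identityʳ _)))

^ᶻ-1 : ∀ z → z ^ᶻ 1ℤ ≈ proj₁ z
^ᶻ-1 z = *-identityʳ _

1^ᶻ : ∀ z → proj₁ z ≈ 1ℂ → ∀ a → z ^ᶻ a ≈ 1ℂ
1^ᶻ = ^ᶻ-unique record { homo-0 = refl ; homo-+ = λ _ _ → sym (*-identityˡ 1ℂ) }

infix 8 _^ᵘ_

_^ᵘ_ : ℂˣ → ℤ → ℂˣ
z ^ᵘ a = z ^ᶻ a , unit⇒#0 (z ^ᶻ a) (z ^ᶻ (ℤ.- a)) (homo-- (^ᶻ-homomorphism z) a)

Homomorphism-∘* : ∀ {h} → Homomorphism h → ∀ a → Homomorphism (λ b → h (a ℤ.* b))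
Homomorphism-∘* {h} H a = record
  { homo-0 = trans (reflexive (≡.cong h (ℤ.*-zeroʳ a))) (homo-0 H)
  ; homo-+ = λ b c → trans (reflexive (≡.cong h (ℤ.*-distribˡ-+ a b c))) (homo-+ H _ _)
  }

^ᶻ-*-assoc : ∀ z a b → (z ^ᵘ a) ^ᶻ b ≈ z ^ᶻ (a ℤ.* b)
^ᶻ-*-assoc z a = ^ᶻ-unique (Homomorphism-∘* (^ᶻ-homomorphism z) a) (z ^ᵘ a)
  (reflexive (≡.cong (z ^ᶻ_) (≡.sym (ℤ.*-identityʳ a))))

-- Integer vectors and monomials on the torus

infixl 6 _+ᵛ_
infixl 7 _·_

_+ᵛ_ : ℤ² → ℤ² → ℤ²
(a , b) +ᵛ (c , d) = a ℤ.+ c , b ℤ.+ d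

_·_ : ℤ → ℤ² → ℤ²
k · (a , b) = k ℤ.* a , k ℤ.* b

^ᵐ-homo-+ᵛ : ∀ θ v w → θ ^ᵐ (v +ᵛ w) ≈ θ ^ᵐ v * θ ^ᵐ w
^ᵐ-homo-+ᵛ (θ₁ , θ₂) (a , b) (c , d) =
  trans (*-cong (^ᶻ-homo-+ θ₁ a c) (^ᶻ-homo-+ θ₂ b d)) (interchange _ _ _ _)

^ᵐ-homomorphism : ∀ θ v → Homomorphism (λ k → θ ^ᵐ (k · v))
^ᵐ-homomorphism θ v@(a , b) = record
  { homo-0 = *-identityˡ 1ℂ
  ; homo-+ = λ k l → trans
      (reflexive (≡.cong (θ ^ᵐ_) (≡.cong₂ _,_ (ℤ.*-distribʳ-+ a k l) (ℤ.*-distribʳ-+ b k l))))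
      (^ᵐ-homo-+ᵛ θ (k · v) (l · v))
  }

1·v≡v : ∀ v → 1ℤ · v ≡ v
1·v≡v (a , b) = ≡.cong₂ _,_ (ℤ.*-identityˡ a) (ℤ.*-identityˡ b)

-1·v≡-ᵛv : ∀ v → ℤ.-1ℤ · v ≡ -ᵛ v
-1·v≡-ᵛv (a , b) = ≡.cong₂ _,_ (ℤ.-1*i≡-i a) (ℤ.-1*i≡-i b)

^ᵐ-inverse : ∀ θ v → θ ^ᵐ v * θ ^ᵐ (-ᵛ v) ≈ 1ℂ
^ᵐ-inverse θ v = begin
  θ ^ᵐ v * θ ^ᵐ (-ᵛ v)               ≡⟨ ≡.cong₂ (λ v w → θ ^ᵐ v * θ ^ᵐ w) (1·v≡v v) (-1·v≡-ᵛv v) ⟨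
  θ ^ᵐ (1ℤ · v) * θ ^ᵐ (ℤ.-1ℤ · v)   ≈⟨ homo-- (^ᵐ-homomorphism θ v) 1ℤ ⟩
  1ℂ                                 ∎

infixr 8 _^ᵐᵘ_

_^ᵐᵘ_ : Torus → ℤ² → ℂˣ
θ ^ᵐᵘ v = θ ^ᵐ v , unit⇒#0 (θ ^ᵐ v) (θ ^ᵐ (-ᵛ v)) (^ᵐ-inverse θ v)

^ᵐ-· : ∀ θ k v → θ ^ᵐ (k · v) ≈ (θ ^ᵐᵘ v) ^ᶻ k
^ᵐ-· θ k v = sym (^ᶻ-unique (^ᵐ-homomorphism θ v) (θ ^ᵐᵘ v) (reflexive (≡.cong (θ ^ᵐ_) (≡.sym (1·v≡v v)))) k)

-- Whether θ^(M_h) equals 1 is undecidable, so "θ^a is a power of θ^(M_h)" is used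
-- in the form "θ^a ≡ 1 modulo θ^(M_h) - 1".
infix 4 _≡1mod_

_≡1mod_ : ℂ → ℂ → Set
z ≡1mod d = ∃[ q ] z ≈ 1ℂ + d * q

module _ {d : ℂ} where

  ≈1⇒≡1mod : ∀ {z} → z ≈ 1ℂ → z ≡1mod d
  ≈1⇒≡1mod {z} z≈1 = 0ℂ , (begin
    z             ≈⟨ z≈1 ⟩
    1ℂ            ≈⟨ +-identityʳ 1ℂ ⟨
    1ℂ + 0ℂ       ≈⟨ +-congˡ (zeroʳ d) ⟨
    1ℂ + d * 0ℂ   ∎)

  ≡1mod-resp-≈ : ∀ {z w} → z ≈ w → z ≡1mod d → w ≡1mod d
  ≡1mod-resp-≈ z≈w (q , eq) = q , trans (sym z≈w) eq

  ≡1mod-* : ∀ {z w} → z ≡1mod d → w ≡1mod d → (z * w) ≡1mod d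
  ≡1mod-* {z} {w} (p , z≈) (q , w≈) = p + q * z , (begin
    z * w                      ≈⟨ *-congˡ w≈ ⟩
    z * (1ℂ + d * q)           ≈⟨ solve 3 (λ z d q → z :* (con 1 :+ d :* q) := z :+ d :* (q :* z)) refl z d q ⟩
    z + d * (q * z)            ≈⟨ +-congʳ z≈ ⟩
    1ℂ + d * p + d * (q * z)   ≈⟨ solve 3 (λ d p r → con 1 :+ d :* p :+ d :* r := con 1 :+ d :* (p :+ r)) refl d p (q * z) ⟩
    1ℂ + d * (p + q * z)       ∎)
    where open SemiringSolver commutativeSemiring

  -- If z = 1 + dq, then w + d(wq) = zw = 1, whence the witness -(wq).
  ≡1mod-inverse : ∀ {z w} → z * w ≈ 1ℂ → z ≡1mod d → w ≡1mod d
  ≡1mod-inverse {z} {w} zw≈1 (q , z≈) = Complex.- (w * q) , (begin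
    w                                           ≈⟨ +-identityʳ w ⟨
    w + 0ℂ                                      ≈⟨ +-congˡ (-‿inverseʳ (d * (w * q))) ⟨
    w + (d * (w * q) - d * (w * q))             ≈⟨ +-assoc w _ _ ⟨
    w + d * (w * q) - d * (w * q)               ≈⟨ +-congʳ (solve 3 (λ w d q → w :+ d :* (w :* q) := (con 1 :+ d :* q) :* w) refl w d q) ⟩
    (1ℂ + d * q) * w - d * (w * q)              ≈⟨ +-cong (trans (*-congʳ (sym z≈)) zw≈1) (-‿distribʳ-* d (w * q)) ⟩
    1ℂ + d * Complex.- (w * q)                  ∎)
    where open SemiringSolver commutativeSemiring

  ≡1mod-^ : ∀ {z} → z ≡1mod d → ∀ n → (z ^ n) ≡1mod d
  ≡1mod-^ z≡1 zero    = ≈1⇒≡1mod refl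
  ≡1mod-^ z≡1 (suc n) = ≡1mod-* z≡1 (≡1mod-^ z≡1 n)

  ≡1mod-^ᶻ : ∀ z → proj₁ z ≡1mod d → ∀ a → (z ^ᶻ a) ≡1mod d
  ≡1mod-^ᶻ z z≡1 (+ n)    = ≡1mod-^ z≡1 n
  ≡1mod-^ᶻ z z≡1 -[1+ n ] =
    ≡1mod-inverse (homo-- (^ᶻ-homomorphism z) (+ suc n)) (≡1mod-^ z≡1 (suc n))

  -- Here d divides z - 1, and a divisor of a nonzero number is nonzero. No decision whether d
  -- vanishes is involved.
  ≡1mod∧#1⇒#0 : ∀ {z} → z ≡1mod d → z # 1ℂ → d #0
  ≡1mod∧#1⇒#0 {z} (q , z≈) z#1 = z*w#0⇒z#0 d q (#0-resp-≈ (begin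
    z - 1ℂ               ≈⟨ +-congʳ z≈ ⟩
    1ℂ + d * q - 1ℂ      ≈⟨ +-congʳ (+-comm 1ℂ (d * q)) ⟩
    d * q + 1ℂ - 1ℂ      ≈⟨ +-assoc (d * q) 1ℂ (Complex.- 1ℂ) ⟩
    d * q + (1ℂ - 1ℂ)    ≈⟨ +-congˡ (-‿inverseʳ 1ℂ) ⟩
    d * q + 0ℂ           ≈⟨ +-identityʳ (d * q) ⟩
    d * q                ∎) z#1)

self-≡1mod : ∀ z → z ≡1mod (z - 1ℂ)
self-≡1mod z = 1ℂ , (begin
  z                         ≈⟨ +-identityˡ z ⟨
  0ℂ + z                    ≈⟨ +-congʳ (-‿inverseʳ 1ℂ) ⟨
  1ℂ - 1ℂ + z               ≈⟨ +-assoc 1ℂ (Complex.- 1ℂ) z ⟩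
  1ℂ + (Complex.- 1ℂ + z)   ≈⟨ +-congˡ (+-comm (Complex.- 1ℂ) z) ⟩
  1ℂ + (z - 1ℂ)             ≈⟨ +-congˡ (*-identityʳ (z - 1ℂ)) ⟨
  1ℂ + (z - 1ℂ) * 1ℂ        ∎)

-- z - 1 divides z^a - 1, for negative a as well.
^ᶻ#1⇒#1 : ∀ z a → z ^ᶻ a # 1ℂ → proj₁ z # 1ℂ
^ᶻ#1⇒#1 z a = ≡1mod∧#1⇒#0 (≡1mod-^ᶻ z (self-≡1mod (proj₁ z)) a)

-- By locality, applied to zw - 1 = (z - 1) + (w - 1)z.
*#1⇒#1⊎#1 : ∀ z w → (z * w) # 1ℂ → z # 1ℂ ⊎ w # 1ℂ
*#1⇒#1⊎#1 z w zw#1 = Sum.map₂ (z*w#0⇒z#0 (w - 1ℂ) z) (z+w#0⇒z#0⊎w#0 (z - 1ℂ) ((w - 1ℂ) * z)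
  (#0-resp-≈ (begin
    z * w - 1ℂ                         ≈⟨ +-congʳ (*-congˡ (proj₂ (self-≡1mod w))) ⟩
    z * (1ℂ + (w - 1ℂ) * 1ℂ) - 1ℂ      ≈⟨ +-congʳ (solve 2 (λ z d → z :* (con 1 :+ d :* con 1) := d :* z :+ z) refl z (w - 1ℂ)) ⟩
    (w - 1ℂ) * z + z - 1ℂ              ≈⟨ +-assoc _ z (Complex.- 1ℂ) ⟩
    (w - 1ℂ) * z + (z - 1ℂ)            ≈⟨ +-comm _ _ ⟩
    (z - 1ℂ) + (w - 1ℂ) * z            ∎) zw#1))
  where open SemiringSolver commutativeSemiring

^ᵐ#1⇒≠e : ∀ θ v → θ ^ᵐ v # 1ℂ → θ ≠e
^ᵐ#1⇒≠e (θ₁ , θ₂) (a , b) = Sum.map (^ᶻ#1⇒#1 θ₁ a) (^ᶻ#1⇒#1 θ₂ b) ∘ *#1⇒#1⊎#1 (θ₁ ^ᶻ a) (θ₂ ^ᶻ b)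

-- Sums over lists in correspondence

module _ {B : Set} (g : B → ℂ) {P : B → Set} where

  ∑-─ : ∀ {ys} (p : Any P ys) → ∑ (map g ys) ≈ g (Any.lookup p) + ∑ (map g (ys ─ p))
  ∑-─ (here _) = refl
  ∑-─ {y ∷ ys} (there p) = begin
    g y + ∑ (map g ys)                                        ≈⟨ +-congˡ (∑-─ p) ⟩
    g y + (g (Any.lookup p) + ∑ (map g (ys ─ p)))             ≈⟨ +-assoc _ _ _ ⟨
    g y + g (Any.lookup p) + ∑ (map g (ys ─ p))               ≈⟨ +-congʳ (+-comm _ _) ⟩
    g (Any.lookup p) + g y + ∑ (map g (ys ─ p))               ≈⟨ +-assoc _ _ _ ⟩
    g (Any.lookup p) + (g y + ∑ (map g (ys ─ p)))             ∎

module _ {B : Set} {P : B → Set} where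

  Any-─ : ∀ {Q : B → Set} {ys} (p : Any P ys) → Any Q ys → Q (Any.lookup p) ⊎ Any Q (ys ─ p)
  Any-─ (here _)  (here qy)  = inj₁ qy
  Any-─ (here _)  (there q)  = inj₂ q
  Any-─ (there p) (here qy)  = inj₂ (here qy)
  Any-─ (there p) (there q)  = Sum.map₂ there (Any-─ p q)

  module _ {R : B → B → Set} where

    AllPairs-─ : ∀ {ys} (p : Any P ys) → AllPairs R ys → AllPairs R (ys ─ p)
    AllPairs-─ (here _)  (_ ∷ rs)  = rs
    AllPairs-─ (there p) (r ∷ rs)  = All.─⁺ p r ∷ AllPairs-─ p rs

    -- Symmetry serves the entries before the removed one, which are related to it in the opposite
    -- order.
    AllPairs⇒All-─ : (∀ {x y} → R x y → R y x) →
                     ∀ {ys} (p : Any P ys) → AllPairs R ys → All (R (Any.lookup p)) (ys ─ p)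
    AllPairs⇒All-─ R-sym (here _)  (r ∷ _)  = r
    AllPairs⇒All-─ R-sym (there p) (r ∷ rs) =
      R-sym (All.lookupAny r p .proj₁) ∷ AllPairs⇒All-─ R-sym p rs

module _ {A B : Set} (_~_ : A → B → Set) (f : A → ℂ) (g : B → ℂ)
         (f≈g : ∀ {a b} → a ~ b → f a ≈ g b) where

  -- Distinctness is expressed through the relation itself, so that no equality on A or B is
  -- involved.
  NoCommonPartnerˡ : A → A → Set
  NoCommonPartnerˡ a a′ = ∀ b → a ~ b → ¬ a′ ~ b

  NoCommonPartnerʳ : B → B → Set
  NoCommonPartnerʳ b b′ = ∀ a → a ~ b → ¬ a ~ b′

  -- Induction on `xs`: the partner of the head is removed from `ys`, and all hypotheses pass to
  -- what remains.
  ∑-correspondence : ∀ xs ys → AllPairs NoCommonPartnerˡ xs → AllPairs NoCommonPartnerʳ ys →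
    All (λ a → Any (a ~_) ys) xs → All (λ b → Any (_~ b) xs) ys → ∑ (map f xs) ≈ ∑ (map g ys)
  ∑-correspondence [] []       _ _ _ _ = refl
  ∑-correspondence [] (_ ∷ _)  _ _ _ (() ∷ _)
  ∑-correspondence (x ∷ xs) ys (x# ∷ xs#) ys# (p ∷ ps) qs = begin
    f x + ∑ (map f xs)                       ≈⟨ +-cong (f≈g x~y) (∑-correspondence xs (ys ─ p) xs# (AllPairs-─ p ys#) ps′ qs′) ⟩
    g (Any.lookup p) + ∑ (map g (ys ─ p))    ≈⟨ ∑-─ g p ⟨
    ∑ (map g ys)                             ∎
    where
    x~y = Any.lookup-result p
    -- A later entry cannot have the removed element as partner, since `x` already has it.
    ps′ = All.zipWith
      (λ (x#x′ , p′) → Sum.[ (λ x′~y → contradiction x′~y (x#x′ _ x~y)) , (λ r → r) ] (Any-─ p p′))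
      (x# , ps)
    -- Likewise no remaining y′ is partnered with `x`, which is the partner of the removed element.
    tail-partner : ∀ {y′} → NoCommonPartnerʳ (Any.lookup p) y′ × Any (_~ y′) (x ∷ xs) → Any (_~ y′) xs
    tail-partner (y#y′ , here x~y′) = contradiction x~y′ (y#y′ x x~y)
    tail-partner (y#y′ , there q)   = q
    qs′ = All.zipWith tail-partner
      (AllPairs⇒All-─ (λ y#y′ a a~y′ a~y → y#y′ a a~y a~y′) p ys# , All.─⁺ p qs)

-- Enumerations as lists of elements with evidence

module _ {A : Set} {P : A → Set} where

  map-proj₁-toList : ∀ {xs} (pxs : All P xs) → map proj₁ (All.toList pxs) ≡ xs
  map-proj₁-toList []         = ≡.refl
  map-proj₁-toList (px ∷ pxs) = ≡.cong (_ ∷_) (map-proj₁-toList pxs)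

  -- Turns a list computed from evidence into the values of an ordinary function, the shape that
  -- `∑-correspondence` takes.
  reduce-map : ∀ {Q : A → Set} {B : Set} (f : ∀ {x} → Q x → B) (g : ∀ {x} → P x → Q x)
               {xs} (pxs : All P xs) →
               reduce f (All.map g pxs) ≡ map (λ (_ , px) → f (g px)) (All.toList pxs)
  reduce-map f g []         = ≡.refl
  reduce-map f g (px ∷ pxs) = ≡.cong (f (g px) ∷_) (reduce-map f g pxs)

module _ {S : Setoid 0ℓ 0ℓ} {P : Setoid.Carrier S → Set} (E : Enumeration S P) where

  open Enumeration E using (sound; unique; complete)

  -- Each element carries its proof, so that summands containing an `inverse` become functions of
  -- the list entry.
  listing : List (∃ P)
  listing = All.toList sound

  listing-unique : AllPairs (λ a b → ¬ Setoid._≈_ S (proj₁ a) (proj₁ b)) listing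
  listing-unique = AllPairs.map⁻ (≡.subst (AllPairs _) (≡.sym (map-proj₁-toList sound)) unique)

  listing-complete : ∀ x → P x → Any (λ a → Setoid._≈_ S x (proj₁ a)) listing
  listing-complete x px = Any.map⁻ (≡.subst (Any _) (≡.sym (map-proj₁-toList sound)) (complete x px))

-- The identities 1/(1 - z^(-c)) = z^c/(z^c - 1) are multiplied together with denominators cleared.
-- The exponents add up to the sum over C that occurs in t.
∏-reciprocals : ∀ {I : Set} {Q : I → Set} {J : Set} (p : ∀ {a} → Q a → ℂ) (ω : J → I) (c : J → ℤ) (z : ℂˣ)
  (k : ∀ h (q : Q (ω h)) → p q * (z ^ᶻ c h - 1ℂ) ≈ z ^ᶻ c h) →
  ∀ hs (nz : All Q (map ω hs)) →
  ∏ (reduce p nz) * σ-denominator (map c hs) z ≈ z ^ᶻ foldr ℤ._+_ 0ℤ (map c hs)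
∏-reciprocals p ω c z k []       []       = *-identityˡ 1ℂ
∏-reciprocals p ω c z k (h ∷ hs) (q ∷ nz) = begin
  (p q * ∏ (reduce p nz)) * ((z ^ᶻ c h - 1ℂ) * σ-denominator (map c hs) z)   ≈⟨ interchange _ _ _ _ ⟩
  (p q * (z ^ᶻ c h - 1ℂ)) * (∏ (reduce p nz) * σ-denominator (map c hs) z)   ≈⟨ *-cong (k h q) (∏-reciprocals p ω c z k hs nz) ⟩
  z ^ᶻ c h * z ^ᶻ foldr ℤ._+_ 0ℤ (map c hs)                                  ≈⟨ ^ᶻ-homo-+ z (c h) (foldr ℤ._+_ 0ℤ (map c hs)) ⟨
  z ^ᶻ (c h ℤ.+ foldr ℤ._+_ 0ℤ (map c hs))                                   ∎

-- Determinants and divisibility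

det : ℤ² → ℤ² → ℤ
det v w = proj₁ v ℤ.* proj₂ w ℤ.- proj₁ w ℤ.* proj₂ v

-- Each coordinate is the expansion of a 3×3 determinant with a repeated row.
cramer : ∀ v w a → det v w · a ≡ det a w · v +ᵛ det v a · w
cramer (v₁ , v₂) (w₁ , w₂) (a₁ , a₂) = ≡.cong₂ _,_
  (solve 6 (λ v₁ v₂ w₁ w₂ a₁ a₂ → (v₁ :* w₂ :- w₁ :* v₂) :* a₁ :=
      (a₁ :* w₂ :- w₁ :* a₂) :* v₁ :+ (v₁ :* a₂ :- a₁ :* v₂) :* w₁) ≡.refl v₁ v₂ w₁ w₂ a₁ a₂)
  (solve 6 (λ v₁ v₂ w₁ w₂ a₁ a₂ → (v₁ :* w₂ :- w₁ :* v₂) :* a₂ :=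
      (a₁ :* w₂ :- w₁ :* a₂) :* v₂ :+ (v₁ :* a₂ :- a₁ :* v₂) :* w₂) ≡.refl v₁ v₂ w₁ w₂ a₁ a₂)
  where open ℤ.+-*-Solver using (solve; _:+_; _:*_; _:-_; _:=_)

-- Serves three times: for the minors in the 1-prime condition, for the order of θ^a, and for the
-- pair s, M_m.
^ᵐ-cramer : ∀ θ v w a → (θ ^ᵐᵘ a) ^ᶻ det v w ≈ (θ ^ᵐᵘ v) ^ᶻ det a w * (θ ^ᵐᵘ w) ^ᶻ det v a
^ᵐ-cramer θ v w a = begin
  (θ ^ᵐᵘ a) ^ᶻ det v w                                ≈⟨ ^ᵐ-· θ (det v w) a ⟨
  θ ^ᵐ (det v w · a)                                  ≡⟨ ≡.cong (θ ^ᵐ_) (cramer v w a) ⟩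
  θ ^ᵐ (det a w · v +ᵛ det v a · w)                   ≈⟨ ^ᵐ-homo-+ᵛ θ (det a w · v) (det v a · w) ⟩
  θ ^ᵐ (det a w · v) * θ ^ᵐ (det v a · w)             ≈⟨ *-cong (^ᵐ-· θ (det a w) v) (^ᵐ-· θ (det v a) w) ⟩
  (θ ^ᵐᵘ v) ^ᶻ det a w * (θ ^ᵐᵘ w) ^ᶻ det v a         ∎

module _ {d : ℂ} (z : ℂˣ) where

  private
    -- These exponents form a subgroup of ℤ, hence are closed under gcds; the lemmas below carry
    -- this out.
    _≡1 : ℤ → Set
    k ≡1 = (z ^ᶻ k) ≡1mod d

  ≡1-+ : ∀ k l → k ≡1 → l ≡1 → (k ℤ.+ l) ≡1
  ≡1-+ k l k≡1 l≡1 = ≡1mod-resp-≈ (sym (^ᶻ-homo-+ z k l)) (≡1mod-* k≡1 l≡1)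

  ≡1-neg : ∀ k → k ≡1 → (ℤ.- k) ≡1
  ≡1-neg k = ≡1mod-inverse (Homomorphism.homo-- (^ᶻ-homomorphism z) k)

  ≡1-*ˡ : ∀ n k → (+ k) ≡1 → (+ (n ℕ.* k)) ≡1
  ≡1-*ˡ zero    k k≡1 = ≈1⇒≡1mod refl
  ≡1-*ˡ (suc n) k k≡1 = ≡1-+ (+ k) (+ (n ℕ.* k)) k≡1 (≡1-*ˡ n k k≡1)

  ≡1-∣∣ : ∀ k → k ≡1 → (+ ∣ k ∣) ≡1
  ≡1-∣∣ (+ _)          k≡1 = k≡1
  ≡1-∣∣ k@(-[1+ _ ]) k≡1 = ≡1-neg k k≡1

  private
    -- Bézout's identity with natural coefficients has a subtractive form; its two cases differ by
    -- exchanging k and l.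
    combination : ∀ g k l x y → g ℕ.+ y ℕ.* l ≡ x ℕ.* k → (+ k) ≡1 → (+ l) ≡1 → (+ g) ≡1
    combination g k l x y eq k≡1 l≡1 = ≡.subst _≡1 difference
      (≡1-+ (+ (x ℕ.* k)) (ℤ.- + (y ℕ.* l)) (≡1-*ˡ x k k≡1) (≡1-neg (+ (y ℕ.* l)) (≡1-*ˡ y l l≡1)))
      where
      difference : + (x ℕ.* k) ℤ.- + (y ℕ.* l) ≡ + g
      difference = ≡.trans (≡.cong (λ s → + s ℤ.- + (y ℕ.* l)) (≡.sym eq))
        (solve 2 (λ a b → (a :+ b) :- b := a) ≡.refl (+ g) (+ (y ℕ.* l)))
        where open ℤ.+-*-Solver using (solve; _:+_; _:-_; _:=_)

  ≡1-gcd : ∀ k l → (+ k) ≡1 → (+ l) ≡1 → (+ ℕ.gcd k l) ≡1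
  ≡1-gcd k l k≡1 l≡1 with ℕ.Bézout.identity (ℕ.gcd-GCD k l)
  ... | ℕ.Bézout.+- x y eq = combination (ℕ.gcd k l) k l x y eq k≡1 l≡1
  ... | ℕ.Bézout.-+ x y eq = combination (ℕ.gcd k l) l k y x eq l≡1 k≡1

  ≡1-gcds : ∀ ks → All (λ k → (+ k) ≡1) ks → (+ foldr ℕ.gcd 0 ks) ≡1
  -- The fold starts from 0, and z^0 = 1.
  ≡1-gcds []       []            = ≈1⇒≡1mod refl
  ≡1-gcds (k ∷ ks) (k≡1 ∷ ks≡1) = ≡1-gcd k _ k≡1 (≡1-gcds ks ks≡1)

^ᵐ-det-≡1mod : ∀ {d} θ v w → (θ ^ᵐ v) ≡1mod d → (θ ^ᵐ w) ≡1mod d →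
               ∀ a → ((θ ^ᵐᵘ a) ^ᶻ det v w) ≡1mod d
^ᵐ-det-≡1mod θ v w v≡1 w≡1 a = ≡1mod-resp-≈ (sym (^ᵐ-cramer θ v w a))
  (≡1mod-* (≡1mod-^ᶻ (θ ^ᵐᵘ v) v≡1 (det a w)) (≡1mod-^ᶻ (θ ^ᵐᵘ w) w≡1 (det v a)))

-- Powers of roots of unity, and reciprocal factors

^ᶻ-*≈1 : ∀ z a → z ^ᶻ a ≈ 1ℂ → ∀ b → z ^ᶻ (a ℤ.* b) ≈ 1ℂ
^ᶻ-*≈1 z a z^a≈1 b = trans (sym (^ᶻ-*-assoc z a b)) (1^ᶻ (z ^ᵘ a) z^a≈1 b)

^ᶻ-periodic : ∀ z N → z ^ᶻ N ≈ 1ℂ → ∀ k → z ^ᶻ (1ℤ ℤ.+ k ℤ.* N) ≈ proj₁ z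
^ᶻ-periodic z N z^N≈1 k = begin
  z ^ᶻ (1ℤ ℤ.+ k ℤ.* N)         ≈⟨ ^ᶻ-homo-+ z 1ℤ (k ℤ.* N) ⟩
  z ^ᶻ 1ℤ * z ^ᶻ (k ℤ.* N)      ≈⟨ *-cong (^ᶻ-1 z) (reflexive (≡.cong (z ^ᶻ_) (ℤ.*-comm k N))) ⟩
  proj₁ z * z ^ᶻ (N ℤ.* k)      ≈⟨ *-congˡ (^ᶻ-*≈1 z N z^N≈1 k) ⟩
  proj₁ z * 1ℂ                  ≈⟨ *-identityʳ (proj₁ z) ⟩
  proj₁ z                       ∎

#1-resp-≈ : ∀ {z w} → z ≈ w → z # 1ℂ → w # 1ℂ
#1-resp-≈ z≈w = #0-resp-≈ (+-congʳ {Complex.- 1ℂ} z≈w)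

module _ {z z′ : ℂ} (zz′≈1 : z * z′ ≈ 1ℂ) where

  [1-z⁻¹]z≈z-1 : (1ℂ - z′) * z ≈ z - 1ℂ
  [1-z⁻¹]z≈z-1 = begin
    (1ℂ - z′) * z               ≈⟨ distribʳ z 1ℂ (Complex.- z′) ⟩
    1ℂ * z + Complex.- z′ * z   ≈⟨ +-cong (*-identityˡ z) (sym (-‿distribˡ-* z′ z)) ⟩
    z - z′ * z                  ≈⟨ +-congˡ (-‿cong (trans (*-comm z′ z) zz′≈1)) ⟩
    z - 1ℂ                      ∎

  #1⇒1-z⁻¹#0 : z # 1ℂ → (1ℂ - z′) #0
  #1⇒1-z⁻¹#0 z#1 = z*w#0⇒z#0 (1ℂ - z′) z (#0-resp-≈ (sym [1-z⁻¹]z≈z-1) z#1)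

  -- This is 1/(1 - 1/z) = z/(z - 1) with z - 1 multiplied out, so that only one denominator asks
  -- for a proof.
  [1-z⁻¹]⁻¹[z-1]≈z : (nz : (1ℂ - z′) #0) → inverse (1ℂ - z′) nz * (z - 1ℂ) ≈ z
  [1-z⁻¹]⁻¹[z-1]≈z nz = begin
    r * (z - 1ℂ)           ≈⟨ *-congˡ [1-z⁻¹]z≈z-1 ⟨
    r * ((1ℂ - z′) * z)    ≈⟨ *-assoc r (1ℂ - z′) z ⟨
    r * (1ℂ - z′) * z      ≈⟨ *-congʳ (trans (*-comm r (1ℂ - z′)) (inverseʳ (1ℂ - z′) nz)) ⟩
    1ℂ * z                 ≈⟨ *-identityˡ z ⟩
    z                      ∎
    where r = inverse (1ℂ - z′) nz

e₁ e₂ : ℤ²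
e₁ = 1ℤ , 0ℤ
e₂ = 0ℤ , 1ℤ

^ᵐ-e₁ : ∀ θ → θ ^ᵐ e₁ ≈ proj₁ (proj₁ θ)
^ᵐ-e₁ (θ₁ , θ₂) = trans (*-identityʳ _) (^ᶻ-1 θ₁)

^ᵐ-e₂ : ∀ θ → θ ^ᵐ e₂ ≈ proj₁ (proj₂ θ)
^ᵐ-e₂ (θ₁ , θ₂) = trans (*-identityˡ _) (^ᶻ-1 θ₂)

-- Nonvanishing of the factors from 1-primality

module _ {n} (M : Matrix n) (one-prime : OnePrime M) (ordered : SlopeOrdered M)
         {i j : Fin n} (i<j : i Fin.< j) where

  private
    Y≢0 : Y M i j ≢ 0ℤ
    Y≢0 = ≡.≢-sym (ℤ.<⇒≢ (ordered i<j))

  -- Modulo θ^(M_h) - 1 all three columns M_i, M_j, M_h give 1. By Cramer's rule z = θ^a raised to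
  -- each of their minors is then 1, and so is z raised to the gcd of the minors, which is 1.
  column-≡1mod : ∀ {h} → h ≢ i → h ≢ j → ∀ θ → θ ^ᵐ M i ≈ 1ℂ → θ ^ᵐ M j ≈ 1ℂ →
                 ∀ a → (θ ^ᵐ a) ≡1mod (θ ^ᵐ M h - 1ℂ)
  column-≡1mod {h} h≢i h≢j θ θ^Mi≈1 θ^Mj≈1 a = ≡1mod-resp-≈ (^ᶻ-1 z)
    (≡.subst (λ k → (z ^ᶻ (+ k)) ≡1mod (θ ^ᵐ M h - 1ℂ))
      -- Columns i and j span already, because Y_ij ≠ 0.
      (one-prime i j h (Fin.<⇒≢ i<j) (≡.≢-sym h≢i) (≡.≢-sym h≢j) (independent⇒Spanning M Y≢0 h))
      (≡1-gcds z (nonzeroMinors M i j h) (All.filter⁺ (λ k → ¬? (k ℕ.≟ 0)) minors≡1)))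
    where
    z = θ ^ᵐᵘ a
    i≡1 = ≈1⇒≡1mod θ^Mi≈1
    j≡1 = ≈1⇒≡1mod θ^Mj≈1
    h≡1 = self-≡1mod (θ ^ᵐ M h)
    minors≡1 : All (λ k → (z ^ᶻ (+ k)) ≡1mod (θ ^ᵐ M h - 1ℂ)) (map ∣_∣ (Y M i j ∷ Y M i h ∷ Y M j h ∷ []))
    -- `det (M i) (M j)` unfolds to `Y M i j`, and similarly for the other two.
    minors≡1 = ≡1-∣∣ z (Y M i j) (^ᵐ-det-≡1mod θ (M i) (M j) i≡1 j≡1 a)
             ∷ ≡1-∣∣ z (Y M i h) (^ᵐ-det-≡1mod θ (M i) (M h) i≡1 h≡1 a)
             ∷ ≡1-∣∣ z (Y M j h) (^ᵐ-det-≡1mod θ (M j) (M h) j≡1 h≡1 a)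
             ∷ []

  -- Some coordinate of θ is apart from 1. The coordinates are θ^e₁ and θ^e₂, so θ^(M_h) - 1 divides
  -- a nonzero number.
  column#1 : ∀ {h} → h ≢ i → h ≢ j → ∀ θ → NontrivialSolution M i j θ → θ ^ᵐ M h # 1ℂ
  column#1 h≢i h≢j θ ((θ^Mi≈1 , θ^Mj≈1) , θ≠e) =
    [ ≡1mod∧#1⇒#0 (≡1mod-resp-≈ (^ᵐ-e₁ θ) (≡1 e₁)) , ≡1mod∧#1⇒#0 (≡1mod-resp-≈ (^ᵐ-e₂ θ) (≡1 e₂)) ] θ≠e
    where ≡1 = column-≡1mod h≢i h≢j θ θ^Mi≈1 θ^Mj≈1

  factorsNonzero : ∀ {θ} → NontrivialSolution M i j θ → FactorsNonzero M i j θ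
  factorsNonzero {θ} sol = All.map⁺ (All.map
    (λ {h} (h≢i , h≢j) → #1⇒1-z⁻¹#0 (^ᵐ-inverse θ (M h)) (column#1 h≢i h≢j θ sol))
    (All.all-filter (λ h → ¬? (h Fin.≟ i) ×-dec ¬? (h Fin.≟ j)) (allFin n)))

^ᵐ-congˡ : ∀ θ θ′ → Setoid._≈_ Torus-setoid θ θ′ → ∀ a → θ ^ᵐ a ≈ θ′ ^ᵐ a
^ᵐ-congˡ (θ₁ , θ₂) (θ₁′ , θ₂′) (θ₁≈ , θ₂≈) (a₁ , a₂) =
  *-cong (^ᶻ-congˡ θ₁ θ₁′ θ₁≈ a₁) (^ᶻ-congˡ θ₂ θ₂′ θ₂≈ a₂)

-- The correspondence between solutions and roots of unity

module Correspondence (v w p : ℤ²) (f g u k : ℤ)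
         (unit : u ℤ.* (f ℤ.* det v p ℤ.+ g ℤ.* det w p) ≡ 1ℤ ℤ.+ k ℤ.* det v w) where

  private
    N = det v w
    s = f · v +ᵛ g · w

  -- This is u det(s, a), spelled as in the theorem, so that the entries of C and the first part of
  -- t unfold to it. In the application `v`, `w`, `p` are M_i, M_j, M_m.
  exponent : ℤ² → ℤ
  exponent a = u ℤ.* (- proj₂ s ℤ.* proj₁ a ℤ.+ proj₁ s ℤ.* proj₂ a)

  infix 4 _~_

  -- Demanded for every a, so that one hypothesis evaluates θ at all columns and at 𝐧.
  _~_ : Torus → ℂˣ → Set
  θ ~ z = ∀ a → θ ^ᵐ a ≈ z ^ᶻ exponent a

  private
    open ℤ.+-*-Solver using (solve; _:+_; _:*_; _:-_; :-_; _:=_)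

    det-s : ∀ a → f ℤ.* det v a ℤ.+ g ℤ.* det w a ≡ det s a
    det-s (a₁ , a₂) = solve 8 (λ f g v₁ v₂ w₁ w₂ a₁ a₂ →
      f :* (v₁ :* a₂ :- a₁ :* v₂) :+ g :* (w₁ :* a₂ :- a₁ :* w₂)
        := (f :* v₁ :+ g :* w₁) :* a₂ :- a₁ :* (f :* v₂ :+ g :* w₂)) ≡.refl
      f g (proj₁ v) (proj₂ v) (proj₁ w) (proj₂ w) a₁ a₂

    exponent-det : ∀ a → exponent a ≡ det s a ℤ.* u
    exponent-det (a₁ , a₂) = solve 5 (λ u s₁ s₂ a₁ a₂ →
      u :* (:- s₂ :* a₁ :+ s₁ :* a₂) := (s₁ :* a₂ :- a₁ :* s₂) :* u) ≡.refl u (proj₁ s) (proj₂ s) a₁ a₂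

    -- det(s, v) = g det(w, v), because det(v, v) = 0. Being a multiple of N, the exponent gives 1
    -- on N-th roots of unity.
    exponent-v : exponent v ≡ N ℤ.* (- (u ℤ.* g))
    exponent-v = solve 7 (λ u f g v₁ v₂ w₁ w₂ →
      u :* (:- (f :* v₂ :+ g :* w₂) :* v₁ :+ (f :* v₁ :+ g :* w₁) :* v₂)
        := (v₁ :* w₂ :- w₁ :* v₂) :* (:- (u :* g))) ≡.refl
      u f g (proj₁ v) (proj₂ v) (proj₁ w) (proj₂ w)

    exponent-w : exponent w ≡ N ℤ.* (u ℤ.* f)
    exponent-w = solve 7 (λ u f g v₁ v₂ w₁ w₂ →
      u :* (:- (f :* v₂ :+ g :* w₂) :* w₁ :+ (f :* v₁ :+ g :* w₁) :* w₂)
        := (v₁ :* w₂ :- w₁ :* v₂) :* (u :* f)) ≡.refl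
      u f g (proj₁ v) (proj₂ v) (proj₁ w) (proj₂ w)

    det-s-p : det s p ℤ.* u ≡ 1ℤ ℤ.+ k ℤ.* N
    det-s-p = ≡.trans (ℤ.*-comm (det s p) u) (≡.trans (≡.cong (u ℤ.*_) (≡.sym (det-s p))) unit)

    exponent-p : exponent p ≡ 1ℤ ℤ.+ k ℤ.* N
    exponent-p = ≡.trans (exponent-det p) det-s-p

    coordinates : ∀ a → u ℤ.* (- proj₂ s) ℤ.* proj₁ a ℤ.+ u ℤ.* proj₁ s ℤ.* proj₂ a ≡ exponent a
    coordinates (a₁ , a₂) = solve 5 (λ u s₁ s₂ a₁ a₂ →
      u :* (:- s₂) :* a₁ :+ u :* s₁ :* a₂ := u :* (:- s₂ :* a₁ :+ s₁ :* a₂)) ≡.refl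
      u (proj₁ s) (proj₂ s) a₁ a₂

    -- The values of `exponent` at `e₁` and `e₂`, which dictate the coordinates of θ.
    c₁ c₂ : ℤ
    c₁ = u ℤ.* (- proj₂ s)
    c₂ = u ℤ.* proj₁ s

  fromRoot : ℂˣ → Torus
  fromRoot z = z ^ᵘ c₁ , z ^ᵘ c₂

  fromRoot~ : ∀ z → fromRoot z ~ z
  fromRoot~ z a = begin
    fromRoot z ^ᵐ a
      ≈⟨ *-cong (^ᶻ-*-assoc z c₁ (proj₁ a)) (^ᶻ-*-assoc z c₂ (proj₂ a)) ⟩
    z ^ᶻ (c₁ ℤ.* proj₁ a) * z ^ᶻ (c₂ ℤ.* proj₂ a)
      ≈⟨ ^ᶻ-homo-+ z (c₁ ℤ.* proj₁ a) (c₂ ℤ.* proj₂ a) ⟨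
    z ^ᶻ (c₁ ℤ.* proj₁ a ℤ.+ c₂ ℤ.* proj₂ a)
      ≡⟨ ≡.cong (z ^ᶻ_) (coordinates a) ⟩
    z ^ᶻ exponent a ∎

  ~-congʳ : ∀ {θ} z z′ → proj₁ z ≈ proj₁ z′ → θ ~ z → θ ~ z′
  ~-congʳ z z′ z≈z′ θ~z a = trans (θ~z a) (^ᶻ-congˡ z z′ z≈z′ (exponent a))

  ~-uniqueˡ : ∀ θ θ′ z → θ ~ z → θ′ ~ z → Setoid._≈_ Torus-setoid θ θ′
  ~-uniqueˡ θ θ′ z θ~z θ′~z =
    trans (sym (^ᵐ-e₁ θ)) (trans (trans (θ~z e₁) (sym (θ′~z e₁))) (^ᵐ-e₁ θ′)) ,
    trans (sym (^ᵐ-e₂ θ)) (trans (trans (θ~z e₂) (sym (θ′~z e₂))) (^ᵐ-e₂ θ′))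

  module _ (z : ℂˣ) (z^N≈1 : z ^ᶻ N ≈ 1ℂ) {θ : Torus} (θ~z : θ ~ z) where

    ~⇒^v≈1 : θ ^ᵐ v ≈ 1ℂ
    ~⇒^v≈1 = trans (θ~z v) (trans (reflexive (≡.cong (z ^ᶻ_) exponent-v)) (^ᶻ-*≈1 z N z^N≈1 _))

    ~⇒^w≈1 : θ ^ᵐ w ≈ 1ℂ
    ~⇒^w≈1 = trans (θ~z w) (trans (reflexive (≡.cong (z ^ᶻ_) exponent-w)) (^ᶻ-*≈1 z N z^N≈1 _))

    -- The exponent at p is 1 + kN, so θ determines its root.
    ~⇒^p≈ : θ ^ᵐ p ≈ proj₁ z
    ~⇒^p≈ = trans (θ~z p) (trans (reflexive (≡.cong (z ^ᶻ_) exponent-p)) (^ᶻ-periodic z N z^N≈1 k))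

  module _ (θ : Torus) (θ^v≈1 : θ ^ᵐ v ≈ 1ℂ) (θ^w≈1 : θ ^ᵐ w ≈ 1ℂ) where

    ^ᵐ-det≈1 : ∀ a → (θ ^ᵐᵘ a) ^ᶻ N ≈ 1ℂ
    ^ᵐ-det≈1 a = trans (^ᵐ-cramer θ v w a)
      (trans (*-cong (1^ᶻ (θ ^ᵐᵘ v) θ^v≈1 (det a w)) (1^ᶻ (θ ^ᵐᵘ w) θ^w≈1 (det v a))) (*-identityˡ 1ℂ))

    private
      θ^s≈1 : θ ^ᵐ s ≈ 1ℂ
      θ^s≈1 = begin
        θ ^ᵐ s                                    ≈⟨ ^ᵐ-homo-+ᵛ θ (f · v) (g · w) ⟩
        θ ^ᵐ (f · v) * θ ^ᵐ (g · w)               ≈⟨ *-cong (^ᵐ-· θ f v) (^ᵐ-· θ g w) ⟩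
        (θ ^ᵐᵘ v) ^ᶻ f * (θ ^ᵐᵘ w) ^ᶻ g           ≈⟨ *-cong (1^ᶻ (θ ^ᵐᵘ v) θ^v≈1 f) (1^ᶻ (θ ^ᵐᵘ w) θ^w≈1 g) ⟩
        1ℂ * 1ℂ                                   ≈⟨ *-identityˡ 1ℂ ⟩
        1ℂ                                        ∎

    solution~ : θ ~ (θ ^ᵐᵘ p)
    solution~ a = begin
      -- As θ^a has order dividing N, raising it to the power 1 + kN = det(s, p) u changes nothing.
      θ ^ᵐ a                                        ≈⟨ ^ᶻ-periodic z N (^ᵐ-det≈1 a) k ⟨
      z ^ᶻ (1ℤ ℤ.+ k ℤ.* N)                         ≡⟨ ≡.cong (z ^ᶻ_) det-s-p ⟨
      z ^ᶻ (det s p ℤ.* u)                          ≈⟨ ^ᶻ-*-assoc z (det s p) u ⟨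
      (z ^ᵘ det s p) ^ᶻ u                           ≈⟨ ^ᶻ-congˡ (z ^ᵘ det s p) ((θ ^ᵐᵘ p) ^ᵘ det s a) z^det-s-p u ⟩
      ((θ ^ᵐᵘ p) ^ᵘ det s a) ^ᶻ u                   ≈⟨ ^ᶻ-*-assoc (θ ^ᵐᵘ p) (det s a) u ⟩
      (θ ^ᵐᵘ p) ^ᶻ (det s a ℤ.* u)                  ≡⟨ ≡.cong ((θ ^ᵐᵘ p) ^ᶻ_) (exponent-det a) ⟨
      (θ ^ᵐᵘ p) ^ᶻ exponent a                       ∎
      where
      z = θ ^ᵐᵘ a
      -- Since θ^s = 1, only the p term of Cramer's rule survives.
      z^det-s-p : z ^ᶻ det s p ≈ (θ ^ᵐᵘ p) ^ᶻ det s a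
      z^det-s-p = trans (^ᵐ-cramer θ s p a)
        (trans (*-congʳ (1^ᶻ (θ ^ᵐᵘ s) θ^s≈1 (det a p))) (*-identityˡ _))

-- Matching one summand with one Fourier-Dedekind term

module _ {n} (M : Matrix n) (i j : Fin n) (E : ℤ² → ℤ) (θ : Torus) (z : ℂˣ)
         (θ~z : ∀ a → θ ^ᵐ a ≈ z ^ᶻ E a) (nz : FactorsNonzero M i j θ) where

  private
    C = map (λ h → E (M h)) (others M i j)
    S = foldr ℤ._+_ 0ℤ C
    D = σ-denominator C z
    Π = ∏ (reduce (λ {ω} → inverse (1ℂ - θ ^ᵐ (-ᵛ ω))) nz)

    Π*D≈z^S : Π * D ≈ z ^ᶻ S
    Π*D≈z^S = ∏-reciprocals (λ {ω} → inverse (1ℂ - θ ^ᵐ (-ᵛ ω))) M (λ h → E (M h)) z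
      (λ h nz → trans (*-congˡ (+-congʳ (sym (θ~z (M h)))))
        (trans ([1-z⁻¹]⁻¹[z-1]≈z (^ᵐ-inverse θ (M h)) nz) (θ~z (M h))))
      (others M i j) nz

  -- Multiplied by the reciprocals of the nonzero factors, `D` becomes a power of the unit z; hence
  -- it is nonzero itself.
  denominator#0 : D #0
  denominator#0 = z*w#0⇒z#0 D Π (#0-resp-≈ (trans (sym Π*D≈z^S) (*-comm Π D)) (proj₂ (z ^ᵘ S)))

  summand≈ : ∀ 𝐧 (D#0 : D #0) → summand M i j 𝐧 θ nz ≈ z ^ᶻ (E 𝐧 ℤ.+ S) * inverse D D#0
  summand≈ 𝐧 D#0 = begin
    θ ^ᵐ 𝐧 * Π                          ≈⟨ *-congˡ (*-identityʳ Π) ⟨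
    θ ^ᵐ 𝐧 * (Π * 1ℂ)                   ≈⟨ *-congˡ (*-congˡ (inverseʳ D D#0)) ⟨
    θ ^ᵐ 𝐧 * (Π * (D * D⁻¹))            ≈⟨ *-congˡ (*-assoc Π D D⁻¹) ⟨
    θ ^ᵐ 𝐧 * (Π * D * D⁻¹)              ≈⟨ *-cong (θ~z 𝐧) (*-congʳ Π*D≈z^S) ⟩
    z ^ᶻ E 𝐧 * (z ^ᶻ S * D⁻¹)           ≈⟨ *-assoc _ _ D⁻¹ ⟨
    z ^ᶻ E 𝐧 * z ^ᶻ S * D⁻¹             ≈⟨ *-congʳ (^ᶻ-homo-+ z (E 𝐧) S) ⟨
    z ^ᶻ (E 𝐧 ℤ.+ S) * D⁻¹              ∎
    where D⁻¹ = inverse D D#0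

-- Equality of the two sums

module _ {n} (M : Matrix n) (one-prime : OnePrime M) (ordered : SlopeOrdered M)
         {i j : Fin n} (i<j : i Fin.< j) (m : Fin n) (m≢i : m ≢ i) (m≢j : m ≢ j) (f g u k : ℤ)
         (unit : u ℤ.* (f ℤ.* Y M i m ℤ.+ g ℤ.* Y M j m) ≡ 1ℤ ℤ.+ k ℤ.* Y M i j) where

  open Correspondence (M i) (M j) (M m) f g u k unit

  private
    N = ∣ Y M i j ∣
    C = map (λ h → exponent (M h)) (others M i j)

    factors : ∀ {θ} → NontrivialSolution M i j θ → FactorsNonzero M i j θ
    factors {θ} = factorsNonzero M one-prime ordered i<j {θ}

    +N≡Y : + N ≡ Y M i j
    +N≡Y = ℤ.0≤i⇒+∣i∣≡i (ℤ.<⇒≤ (ordered i<j))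

    ^Y≈1 : ∀ z → NontrivialRoot N z → z ^ᶻ Y M i j ≈ 1ℂ
    ^Y≈1 z (z^N≈1 , _) = trans (reflexive (≡.cong (z ^ᶻ_) (≡.sym +N≡Y))) z^N≈1

    fromRoot-solution : ∀ z → NontrivialRoot N z → NontrivialSolution M i j (fromRoot z)
    fromRoot-solution z root@(_ , z#1) =
      ( ~⇒^v≈1 z (^Y≈1 z root) {fromRoot z} (fromRoot~ z)
      , ~⇒^w≈1 z (^Y≈1 z root) {fromRoot z} (fromRoot~ z)) ,
      -- θ ≠ e because θ^(M_m) = z is apart from 1.
      ^ᵐ#1⇒≠e (fromRoot z) (M m) (#1-resp-≈ (sym (~⇒^p≈ z (^Y≈1 z root) {fromRoot z} (fromRoot~ z))) z#1)

    -- 1-primality enters again: as m differs from i and j, `column#1` keeps θ^(M_m) apart from 1.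
    toRoot-root : ∀ θ → NontrivialSolution M i j θ → NontrivialRoot N (θ ^ᵐᵘ M m)
    toRoot-root θ sol@((θ^Mi≈1 , θ^Mj≈1) , _) =
      trans (reflexive (≡.cong ((θ ^ᵐᵘ M m) ^ᶻ_) +N≡Y)) (^ᵐ-det≈1 θ θ^Mi≈1 θ^Mj≈1 (M m)) ,
      column#1 M one-prime ordered i<j m≢i m≢j θ sol

    -- Transported from the solution `fromRoot z`, whose factors are nonzero.
    denominator : ∀ {z} → NontrivialRoot N z → σ-denominator C z #0
    denominator {z} root =
      denominator#0 M i j exponent (fromRoot z) z (fromRoot~ z) (factors {fromRoot z} (fromRoot-solution z root))

    _~′_ : ∃ (NontrivialSolution M i j) → ∃ (NontrivialRoot N) → Set
    (θ , _) ~′ (z , _) = θ ~ z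

  module _ (Θ : NontrivialSolutions M i j) (Λ : NontrivialRoots N) where

    open Enumeration

    solutionSum-defined : SolutionSumDefined M i j Θ
    solutionSum-defined = All.map (λ {θ} → factors {θ}) (sound Θ)

    σ-defined : σ-Defined C N Λ
    σ-defined = All.map (λ {z} → denominator {z}) (sound Λ)

    private
      -- The enumeration contains θ^(M_m) only up to the equality of ℂ, so the relation is moved
      -- along that equality.
      partner-of-solution : ∀ a → Any (a ~′_) (listing Λ)
      partner-of-solution (θ , sol@((θ^Mi≈1 , θ^Mj≈1) , _)) = Any.map
        (λ {(z , _)} z₀≈z → ~-congʳ {θ} (θ ^ᵐᵘ M m) z z₀≈z (solution~ θ θ^Mi≈1 θ^Mj≈1))
        (listing-complete Λ (θ ^ᵐᵘ M m) (toRoot-root θ sol))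

      partner-of-root : ∀ b → Any (_~′ b) (listing Θ)
      partner-of-root (z , root) = Any.map
        (λ {(θ , _)} fromRoot≈θ a → trans
          (^ᵐ-congˡ θ (fromRoot z) (Setoid.sym Torus-setoid {fromRoot z} {θ} fromRoot≈θ) a)
          (fromRoot~ z a))
        (listing-complete Θ (fromRoot z) (fromRoot-solution z root))

    module _ (𝐧 : ℤ²) where

      private
        t = exponent 𝐧 ℤ.+ foldr ℤ._+_ 0ℤ C

        θ-term : ∀ {θ} → FactorsNonzero M i j θ → ℂ
        θ-term {θ} = summand M i j 𝐧 θ

        z-term : ∀ {z} → σ-denominator C z #0 → ℂ
        z-term {z} D#0 = z ^ᶻ t * inverse (σ-denominator C z) D#0

        F : ∃ (NontrivialSolution M i j) → ℂ
        F (θ , sol) = θ-term {θ} (factors {θ} sol)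

        G : ∃ (NontrivialRoot N) → ℂ
        G (z , root) = z-term {z} (denominator {z} root)

        F≈G : ∀ {a b} → a ~′ b → F a ≈ G b
        F≈G {θ , sol} {z , root} θ~z =
          summand≈ M i j exponent θ z θ~z (factors {θ} sol) 𝐧 (denominator {z} root)

      ∑≈∑ : solutionSum M i j 𝐧 Θ solutionSum-defined ≈ ∑ (reduce (λ {z} → z-term {z}) σ-defined)
      ∑≈∑ = begin
        ∑ (reduce (λ {θ} → θ-term {θ}) solutionSum-defined)
          ≡⟨ ≡.cong ∑ (reduce-map (λ {θ} → θ-term {θ}) (λ {θ} → factors {θ}) (sound Θ)) ⟩
        ∑ (map F (listing Θ))
          ≈⟨ ∑-correspondence _~′_ F G (λ {a} {b} → F≈G {a} {b}) (listing Θ) (listing Λ)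
               -- Solutions with a common root agree in both coordinates.
               (AllPairs.map (λ {(θ , _)} {(θ′ , _)} θ≉θ′ (z , _) θ~z θ′~z → θ≉θ′ (~-uniqueˡ θ θ′ z θ~z θ′~z))
                 (listing-unique Θ))
               -- Roots with a common solution θ both equal θ^(M_m).
               (AllPairs.map (λ {(z , root)} {(z′ , root′)} z≉z′ (θ , _) θ~z θ~z′ →
                   z≉z′ (trans (sym (~⇒^p≈ z (^Y≈1 z root) {θ} θ~z)) (~⇒^p≈ z′ (^Y≈1 z′ root′) {θ} θ~z′)))
                 (listing-unique Λ))
               (All.universal partner-of-solution (listing Θ))
               (All.universal partner-of-root (listing Λ)) ⟩
        ∑ (map G (listing Λ))
          ≡⟨ ≡.cong ∑ (reduce-map (λ {z} → z-term {z}) (λ {z} → denominator {z}) (sound Λ)) ⟨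
        ∑ (reduce (λ {z} → z-term {z}) σ-defined) ∎

      solutionSum≈σ : .{{_ : ℕ.NonZero N}} →
        Complex.ratio (1ℤ ℚ./ N) * solutionSum M i j 𝐧 Θ solutionSum-defined ≈ σ t C N Λ σ-defined
      solutionSum≈σ = *-congˡ {Complex.ratio (1ℤ ℚ./ N)} ∑≈∑

-- From the congruence for u to the theorem

∣⇒quotient : ∀ N a → N ∣ (a ℤ.- 1ℤ) → Σ[ k ∈ ℤ ] a ≡ 1ℤ ℤ.+ k ℤ.* N
∣⇒quotient N a N∣a-1 = quotient , ≡.trans (solve 1 (λ a → a := con 1ℤ :+ (a :- con 1ℤ)) ≡.refl a)
    (≡.cong (ℤ._+_ 1ℤ) equality)
  where
  open Signed._∣_ (Signed.∣ᵤ⇒∣ {N} {a ℤ.- 1ℤ} N∣a-1)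
  open ℤ.+-*-Solver using (solve; con; _:+_; _:-_; _:=_)

lemma2 :
    ∀ {n} → 3 ℕ.≤ n →
    (M : Matrix n) → OnePrime M → (ordered : SlopeOrdered M) →
    ∀ {i j} (i<j : i Fin.< j) (n₁ n₂ : ℤ) (m : Fin n) → m ≢ i → m ≢ j →
    (f g : ℤ) → gcd (f ℤ.* Y M i m ℤ.+ g ℤ.* Y M j m) (Y M i j) ≡ 1ℤ →
    (u : ℤ) → Y M i j ∣ (u ℤ.* (f ℤ.* Y M i m ℤ.+ g ℤ.* Y M j m) ℤ.- 1ℤ) →
    let X₀ = f ℤ.* x M i ℤ.+ g ℤ.* x M j
        Y₀ = f ℤ.* y M i ℤ.+ g ℤ.* y M j
        C = map (λ h → u ℤ.* (- Y₀ ℤ.* x M h ℤ.+ X₀ ℤ.* y M h)) (others M i j)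
        t = u ℤ.* (- Y₀ ℤ.* n₁ ℤ.+ X₀ ℤ.* n₂) ℤ.+ foldr ℤ._+_ 0ℤ C
        N = ∣ Y M i j ∣
        instance N≢0 = ℤ.>-nonZero (ordered i<j)
    in
    (Θ : NontrivialSolutions M i j) (Λ : NontrivialRoots N) →
    Σ[ dΘ ∈ SolutionSumDefined M i j Θ ] Σ[ dΛ ∈ σ-Defined C N Λ ]
      Complex.ratio (1ℤ ℚ./ N) Complex.* solutionSum M i j (n₁ , n₂) Θ dΘ
        Complex.≈ σ t C N Λ dΛ
lemma2 _ M one-prime ordered {i} {j} i<j n₁ n₂ m m≢i m≢j f g _ u Y∣uW-1 Θ Λ =
  solutionSum-defined M one-prime ordered i<j m m≢i m≢j f g u k unit Θ Λ ,
  σ-defined M one-prime ordered i<j m m≢i m≢j f g u k unit Θ Λ ,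
  solutionSum≈σ M one-prime ordered i<j m m≢i m≢j f g u k unit Θ Λ (n₁ , n₂) {{ℤ.>-nonZero (ordered i<j)}}
  where
  quotient = ∣⇒quotient (Y M i j) (u ℤ.* (f ℤ.* Y M i m ℤ.+ g ℤ.* Y M j m)) Y∣uW-1
  k = proj₁ quotient
  unit = proj₂ quotient
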